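{- Let $q$ be a power of a prime $p$. Let $A,B\subseteq \mathbb{F}_q$ be sets such that $|A|=m \geq 2$, $|B|=n \geq 2$, and $mn \leq q$. Then the set of points $A\times B\subseteq AG(2,q)$ determines at least $$mn-\min \{p^{s_1}(n-1),\, p^{s_2}(m-1)\}+1$$ directions, where $s_1$ is the largest integer such that $p^{s_1}n \leq q$ and $s_2$ is the largest integer such that $p^{s_2}m \leq q$.
   Context: $\mathbb{F}_q$ is the finite field with $q$ elements and $AG(2,q)$ is the affine plane over $\mathbb{F}_q$, whose points are identified with $\mathbb{F}_q\times\mathbb{F}_q$ via Cartesian coordinates. For a set of points $U=\{(x_i,y_i): 1\le i\le |U|\}\subseteq AG(2,q)$, the set of directions determined by $U$ is $$\mathcal{D}_U=\left\{\frac{y_j-y_i}{x_j-x_i}: 1\le i<j\le |U|\right\}\subseteq \mathbb{F}_q\cup\{\infty\},$$ where the quotient is $\infty$ (the vertical direction) when $x_i=x_j$. The number of directions determined by $U$ is $|\mathcal{D}_U|$ (so the direction $\infty$ is counted if it occurs). -}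

module Defs where

open import Algebra.Apartness.Structures using (IsHeytingField)
open import Algebra.Core using (Op₁; Op₂)
open import Data.Fin using (Fin)
open import Data.Fin.Properties using (inj⇒≟)
open import Data.List using (List; []; _∷_; _++_; map; length; deduplicate)
open import Data.Maybe using (Maybe; just; nothing)
import Data.Maybe.Properties as Maybe
open import Data.Nat using (ℕ; _≤_)
open import Data.Product using (_×_; _,_; proj₁)
open import Function.Bundles using (_↔_)
open import Function.Properties.Inverse using (↔⇒↣)
open import Level using (Level; suc)
open import Relation.Binary.Definitions using (DecidableEquality)
open import Relation.Binary.PropositionalEquality using (_≡_; _≢_)
open import Relation.Nullary using (yes; no)

-- A Heyting field whose apartness is inequality is a field in the usual sense:
-- 0 ≢ 1, and x - y is invertible exactly when x ≢ y.
record FiniteField (c : Level) (q : ℕ) : Set (suc c) where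
  infixl 7 _*_
  infixl 6 _+_
  field
    Carrier        : Set c
    _+_ _*_        : Op₂ Carrier
    -_             : Op₁ Carrier
    0# 1#          : Carrier
    isHeytingField : IsHeytingField _≡_ _≢_ _+_ _*_ -_ 0# 1#
    enumeration    : Carrier ↔ Fin q

  open IsHeytingField isHeytingField public using (_-_; #⇒invertible)

  _≟_ : DecidableEquality Carrier
  _≟_ = inj⇒≟ (↔⇒↣ enumeration)

module Directions {c : Level} {q : ℕ} (F : FiniteField c q) where
  open FiniteField F

  Point : Set c
  Point = Carrier × Carrier

  Direction : Set c
  Direction = Maybe Carrier

  pattern ∞ = nothing

  direction : Point → Point → Direction
  direction (xᵢ , yᵢ) (xⱼ , yⱼ) with xⱼ ≟ xᵢ
  ... | yes _     = ∞
  ... | no  xⱼ≢xᵢ = just ((yⱼ - yᵢ) * proj₁ (#⇒invertible xⱼ≢xᵢ))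

  -- One entry for each pair i < j of positions, so with repetitions.
  directions : List Point → List Direction
  directions []      = []
  directions (P ∷ U) = map (direction P) U ++ directions U

  -- The number of directions determined by a set of points, the set being
  -- given as a list without repetitions.
  numDirections : List Point → ℕ
  numDirections U = length (deduplicate (Maybe.≡-dec _≟_) (directions U))

IsLargest : (ℕ → Set) → ℕ → Set
IsLargest P s = P s × (∀ t → P t → t ≤ s)

-- The polynomial method of Rédei and Szőnyi. For each slope y let
-- H_y = ∏ (X + (b − a y)) over (a , b) in A × B, and let W_y ≡ X^q modulo terms
-- of degree < mn be a multiple of H_y. If y is not a determined direction, the
-- roots of H_y are distinct, so H_y divides X^q − X and the coefficients of W_y
-- between X and X^q vanish. The coefficient of X^i in W_y is a polynomial in y
-- of degree at most q − i, so when i is at least the number d of directions it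
-- has more zeros than its degree and vanishes for every y, in particular y = 0.
-- Now W_0 = X^q + (terms of degree < d) has each −b, b in B, as an m-fold root;
-- dividing all exponents by the largest possible power of p and differentiating
-- once bounds d from below. The second bound follows by exchanging A and B.
module Submission where

open import Defs
open import Data.Integer using (+_; 1ℤ) renaming (_+_ to _+ℤ_; _-_ to _-ℤ_; _≤_ to _≤ℤ_)
open import Data.List using (List; length; cartesianProduct)
open import Data.List.Relation.Unary.Unique.Propositional using (Unique)
open import Data.Nat using (ℕ; _*_; _∸_; _^_; _⊓_; _≤_)
open import Data.Nat.Primality using (Prime)
open import Level using (Level)
open import Relation.Binary.PropositionalEquality using (_≡_)
open import Algebra.Apartness.Structures using (IsHeytingField)
open import Algebra.Bundles using (CommutativeRing)
import Algebra.Properties.Ring as RingProperties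
import Algebra.Properties.Semiring.Exp as SemiringExp
import Algebra.Properties.Semiring.Mult as SemiringMult
import Algebra.Solver.Ring.NaturalCoefficients.Default as SemiringSolver
open import Data.Empty using (⊥-elim)
open import Data.Integer using (+≤+; -_)
import Data.Integer.Properties as ℤ
open import Data.List using ([]; _∷_; _++_; deduplicate; map; filter; foldr; allFin)
import Data.List.Membership.DecPropositional as DecMembership
open import Data.List.Membership.Propositional using (_∈_; _∉_)
open import Data.List.Membership.Propositional.Properties
  using (∈-map⁺; ∈-map⁻; ∈-++⁺ˡ; ∈-++⁺ʳ; ∈-++⁻; ∈-∃++; ∈-allFin; ∈-filter⁺; ∈-filter⁻;
         ∈-cartesianProduct⁺; ∈-cartesianProduct⁻; ∈-deduplicate⁺)
open import Data.List.Membership.Propositional.Properties.WithK using (unique∧set⇒bag)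
open import Data.List.Properties using (length-map; length-++; length-tabulate; ++-identityʳ)
open import Data.List.Relation.Binary.BagAndSetEquality using (∼bag⇒↭)
open import Data.List.Relation.Binary.Permutation.Propositional using (_↭_; ↭⇒↭ₛ)
open import Data.List.Relation.Binary.Permutation.Propositional.Properties using (↭-length)
open import Data.List.Relation.Binary.Permutation.Setoid.Properties using (foldr-commMonoid)
open import Data.List.Relation.Unary.All as All using ([]; _∷_)
open import Data.List.Relation.Unary.AllPairs using ([]; _∷_)
open import Data.List.Relation.Unary.Any using (here; there)
open import Data.List.Relation.Unary.Unique.Propositional.Properties
  using (map⁺; filter⁺; allFin⁺; cartesianProduct⁺)
open import Data.Maybe using (Maybe; just; nothing)
import Data.Maybe.Properties as Maybe
open import Data.Nat using (zero; suc; pred; >-nonZero; _+_; _<_; z≤n; s≤s; _⊔_)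
open import Data.Nat.Coprimality using (Coprime; coprime-Bézout)
open import Data.Nat.Divisibility using (_∣_; _∣?_; divides; _∤_; >⇒∤; ∣m∣n⇒∣m+n)
open import Data.Nat.DivMod using (_/_; m/n*n≤m; m%n<n; m≡m%n+[m/n]*n)
open import Data.Nat.GCD using (module Bézout)
open import Data.Nat.Primality using (prime⇒irreducible; prime⇒nonZero; ¬prime[0])
import Data.Nat.Properties as ℕ
open import Data.Product using (_×_; _,_; ∃; ∃₂; proj₁; proj₂)
open import Data.Sum as Sum using (_⊎_; inj₁; inj₂)
open import Function.Bundles using (Inverse; mk⇔)
open import Relation.Binary.Definitions using (tri<; tri≈; tri>)
open import Relation.Binary.PropositionalEquality
  using (_≢_; _≗_; refl; sym; trans; cong; cong₂; subst; subst₂; setoid; module ≡-Reasoning)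
open import Relation.Nullary using (¬_; yes; no)
open import Relation.Nullary.Decidable using (¬?; _×-dec_)

-- Since m is at least 2, slope 0 is itself a determined direction, so the roots of H_0 collide and
-- nothing can be said about W_0 directly. This is why the coefficients are followed as polynomials
-- in y: they carry the vanishing from the undetermined slopes to slope 0. The count is just
-- sufficient: ∞ is determined because n is at least 2, so q + 1 - d of the q finite slopes are
-- undetermined, one more than the degree q - i allows when i = d. To keep polynomial dependence on
-- y, W_y is built from H_y without any division. The term p^s (n - 1) arises as follows. Let W_0 be
-- a polynomial in X^(p^s), with s as large as possible. After division of the exponents by p^s each
-- of the n roots keeps multiplicity at least m / p^s, and differentiating costs one at each root: a
-- loss of p^s n in the original scale. The derivative has degree strictly below (d - 1) / p^s,
-- because the leading term disappears, and this strictness gives back p^s. The n roots stay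
-- distinct in a polynomial of degree q / p^s, whence p^s n ≤ q.

-- Polynomials and multiplicities of their roots.

module Polynomials {c : Level} {q : ℕ} (F : FiniteField c q) where
  open FiniteField F public
    hiding (_-_; #⇒invertible) renaming (_+_ to infixl 6 _⊕_; _*_ to infixl 7 _⊗_; -_ to ⊖_)
  open IsHeytingField isHeytingField using (isCommutativeRing; #⇒invertible; invertible⇒#; *-comm)

  commutativeRing : CommutativeRing c c
  commutativeRing = record { isCommutativeRing = isCommutativeRing }

  open CommutativeRing commutativeRing public
    using (ring; semiring; commutativeSemiring; +-identityˡ; +-identityʳ; *-identityˡ; *-identityʳ; -‿inverseʳ; zeroˡ; zeroʳ)
  open SemiringMult semiring public using (×1-homo-*) renaming (_×_ to _·_)
  open SemiringSolver commutativeSemiring public using (solve; _:=_; _:+_; _:*_; con)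

  1≢0 : 1# ≢ 0#
  1≢0 = invertible⇒# (1# , 1⊗[1-0]≡1 , trans (*-comm _ _) 1⊗[1-0]≡1)
    where
    open RingProperties ring using (-0#≈0#)
    1⊗[1-0]≡1 : 1# ⊗ (1# ⊕ ⊖ 0#) ≡ 1#
    1⊗[1-0]≡1 = trans (*-identityˡ _) (trans (cong (1# ⊕_) -0#≈0#) (+-identityʳ 1#))

  -- Matching on the equation replaces x by `y ⊕ d`, so later identities contain no subtraction and
  -- fall to the semiring solver.
  difference : ∀ {x y} → x ≢ y → ∃₂ λ d ι → x ≡ y ⊕ d × ι ⊗ d ≡ 1#
  difference {x} {y} x≢y with ι , ι⊗[x-y]≡1 , _ ← #⇒invertible x≢y =
    x ⊕ ⊖ y , ι , sym (begin
      y ⊕ (x ⊕ ⊖ y)  ≡⟨ solve 3 (λ x y z → y :+ (x :+ z) := x :+ (y :+ z)) refl x y (⊖ y) ⟩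
      x ⊕ (y ⊕ ⊖ y)  ≡⟨ cong (x ⊕_) (-‿inverseʳ y) ⟩
      x ⊕ 0#         ≡⟨ +-identityʳ x ⟩
      x              ∎) , ι⊗[x-y]≡1
    where open ≡-Reasoning

  inverse : ∀ {x} → x ≢ 0# → ∃ λ ι → ι ⊗ x ≡ 1#
  inverse x≢0 with d , ι , x≡0+d , ι⊗d≡1 ← difference x≢0 =
    ι , trans (cong (ι ⊗_) (trans x≡0+d (+-identityˡ d))) ι⊗d≡1

  ⊗-cancelˡ-0 : ∀ {x y} → x ≢ 0# → x ⊗ y ≡ 0# → y ≡ 0#
  ⊗-cancelˡ-0 {x} {y} x≢0 x⊗y≡0 with ι , ι⊗x≡1 ← inverse x≢0 = begin
    y             ≡⟨ *-identityˡ y ⟨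
    1# ⊗ y        ≡⟨ cong (_⊗ y) ι⊗x≡1 ⟨
    (ι ⊗ x) ⊗ y   ≡⟨ solve 3 (λ ι x y → (ι :* x) :* y := ι :* (x :* y)) refl ι x y ⟩
    ι ⊗ (x ⊗ y)   ≡⟨ cong (ι ⊗_) x⊗y≡0 ⟩
    ι ⊗ 0#        ≡⟨ zeroʳ ι ⟩
    0#            ∎
    where open ≡-Reasoning

  -- A polynomial is its sequence of coefficients, constant coefficient first;
  -- the bounds on the degree are carried separately.
  Poly : Set c
  Poly = ℕ → Carrier

  DegLt : ℕ → Poly → Set c
  DegLt n P = ∀ i → n ≤ i → P i ≡ 0#

  Bounded : Poly → Set c
  Bounded P = ∃ λ n → DegLt n P

  one : Poly
  one zero    = 1#
  one (suc _) = 0#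

  combine : Carrier → Poly → Carrier → Poly → Poly
  combine x P y Q i = x ⊗ P i ⊕ y ⊗ Q i

  -- (X + r) P; writing roots as −r keeps subtraction out of the formulas.
  lin : Carrier → Poly → Poly
  lin r P zero    = r ⊗ P zero
  lin r P (suc i) = P i ⊕ r ⊗ P (suc i)

  degLt-resp : ∀ {n P Q} → P ≗ Q → DegLt n P → DegLt n Q
  degLt-resp P≗Q d i n≤i = trans (sym (P≗Q i)) (d i n≤i)

  degLt-weaken : ∀ {m n P} → m ≤ n → DegLt m P → DegLt n P
  degLt-weaken m≤n d i n≤i = d i (ℕ.≤-trans m≤n n≤i)

  0⊗0 : ∀ {x y a b} → a ≡ 0# → b ≡ 0# → x ⊗ a ⊕ y ⊗ b ≡ 0#
  0⊗0 {x} {y} refl refl = trans (cong₂ _⊕_ (zeroʳ x) (zeroʳ y)) (+-identityˡ 0#)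

  0⊕0 : ∀ {r a b} → a ≡ 0# → b ≡ 0# → a ⊕ r ⊗ b ≡ 0#
  0⊕0 {r} refl refl = trans (+-identityˡ _) (zeroʳ r)

  degLt-combine : ∀ {n P Q x y} → DegLt n P → DegLt n Q → DegLt n (combine x P y Q)
  degLt-combine dP dQ i n≤i = 0⊗0 (dP i n≤i) (dQ i n≤i)

  bounded-combine : ∀ {P Q x y} → Bounded P → Bounded Q → Bounded (combine x P y Q)
  bounded-combine (m , dP) (n , dQ) = m ⊔ n ,
    degLt-combine (degLt-weaken (ℕ.m≤m⊔n m n) dP) (degLt-weaken (ℕ.m≤n⊔m m n) dQ)

  degLt-lin : ∀ {n r P} → DegLt n P → DegLt (suc n) (lin r P)
  degLt-lin d (suc i) (s≤s n≤i) = 0⊕0 (d i n≤i) (d (suc i) (ℕ.m≤n⇒m≤1+n n≤i))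

  bounded-lin : ∀ {r P} → Bounded P → Bounded (lin r P)
  bounded-lin (n , d) = suc n , degLt-lin d

  -- `Bounded P` excludes power series such as the inverse of X + r. A known bound is lowered one
  -- step at a time: once the coefficient of P at i + 1 is 0, that of (X + r) P at i + 1 is `P i`.
  degLt-unlin : ∀ {n r P} → Bounded P → DegLt (suc n) (lin r P) → DegLt n P
  degLt-unlin {n} {r} {P} (m , d) d′ = descend m d
    where
    open ≡-Reasoning
    descend : ∀ m → DegLt m P → DegLt n P
    descend zero    d i _ = d i z≤n
    descend (suc m) d with n ℕ.≤? m
    ... | no  n≰m = degLt-weaken (ℕ.≰⇒> n≰m) d
    ... | yes n≤m = descend m λ i m≤i → begin
      P i                    ≡⟨ +-identityʳ (P i) ⟨
      P i ⊕ 0#               ≡⟨ cong (P i ⊕_) (zeroʳ r) ⟨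
      P i ⊕ r ⊗ 0#           ≡⟨ cong (λ x → P i ⊕ r ⊗ x) (d (suc i) (s≤s m≤i)) ⟨
      lin r P (suc i)        ≡⟨ d′ (suc i) (s≤s (ℕ.≤-trans n≤m m≤i)) ⟩
      0#                     ∎

  lin-cong : ∀ r {P Q} → P ≗ Q → lin r P ≗ lin r Q
  lin-cong r P≗Q zero    = cong (r ⊗_) (P≗Q zero)
  lin-cong r P≗Q (suc i) = cong₂ (λ x y → x ⊕ r ⊗ y) (P≗Q i) (P≗Q (suc i))

  lin-combine : ∀ r x P y Q → lin r (combine x P y Q) ≗ combine x (lin r P) y (lin r Q)
  lin-combine r x P y Q zero = solve 5 (λ r x y a b →
    r :* (x :* a :+ y :* b) := x :* (r :* a) :+ y :* (r :* b)) refl r x y (P 0) (Q 0)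
  lin-combine r x P y Q (suc i) = solve 7 (λ r x y a b a′ b′ →
    (x :* a :+ y :* b) :+ r :* (x :* a′ :+ y :* b′) :=
    x :* (a :+ r :* a′) :+ y :* (b :+ r :* b′)) refl r x y (P i) (Q i) (P (suc i)) (Q (suc i))

  lin-comm : ∀ r s P → lin r (lin s P) ≗ lin s (lin r P)
  lin-comm r s P zero = solve 3 (λ r s a → r :* (s :* a) := s :* (r :* a)) refl r s (P 0)
  lin-comm r s P (suc zero) = solve 4 (λ r s a b →
    s :* a :+ r :* (a :+ s :* b) := r :* a :+ s :* (a :+ r :* b)) refl r s (P 0) (P 1)
  lin-comm r s P (suc (suc i)) = solve 5 (λ r s a b d →
    (a :+ s :* b) :+ r :* (b :+ s :* d) := (a :+ r :* b) :+ s :* (b :+ r :* d))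
    refl r s (P i) (P (suc i)) (P (suc (suc i)))

  lin-⊕ : ∀ r d P i → lin (r ⊕ d) P i ≡ lin r P i ⊕ d ⊗ P i
  lin-⊕ r d P zero    = solve 3 (λ r d a → (r :+ d) :* a := r :* a :+ d :* a) refl r d (P 0)
  lin-⊕ r d P (suc i) = solve 4 (λ r d a b →
    a :+ (r :+ d) :* b := (a :+ r :* b) :+ d :* b) refl r d (P i) (P (suc i))

  -1# : Carrier
  -1# = ⊖ 1#

  x⊕[-1⊗x]≡0 : ∀ x → x ⊕ -1# ⊗ x ≡ 0#
  x⊕[-1⊗x]≡0 x = begin
    x ⊕ -1# ⊗ x        ≡⟨ cong (_⊕ -1# ⊗ x) (*-identityˡ x) ⟨
    1# ⊗ x ⊕ -1# ⊗ x   ≡⟨ solve 3 (λ x y z → y :* x :+ z :* x := (y :+ z) :* x) refl x 1# -1# ⟩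
    (1# ⊕ -1#) ⊗ x     ≡⟨ cong (_⊗ x) (-‿inverseʳ 1#) ⟩
    0# ⊗ x             ≡⟨ zeroˡ x ⟩
    0#                 ∎
    where open ≡-Reasoning

  x⊕[-1⊗y]≡0⇒x≡y : ∀ {x y} → x ⊕ -1# ⊗ y ≡ 0# → x ≡ y
  x⊕[-1⊗y]≡0⇒x≡y {x} {y} eq = begin
    x                     ≡⟨ +-identityʳ x ⟨
    x ⊕ 0#                ≡⟨ cong (x ⊕_) (x⊕[-1⊗x]≡0 y) ⟨
    x ⊕ (y ⊕ -1# ⊗ y)     ≡⟨ solve 3 (λ x y z → x :+ (y :+ z) := y :+ (x :+ z)) refl x y (-1# ⊗ y) ⟩
    y ⊕ (x ⊕ -1# ⊗ y)     ≡⟨ cong (y ⊕_) eq ⟩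
    y ⊕ 0#                ≡⟨ +-identityʳ y ⟩
    y                     ∎
    where open ≡-Reasoning

  1⊗x⊕[-1⊗y]≡0⇒x≡y : ∀ {x y} → 1# ⊗ x ⊕ -1# ⊗ y ≡ 0# → x ≡ y
  1⊗x⊕[-1⊗y]≡0⇒x≡y {x} {y} eq = x⊕[-1⊗y]≡0⇒x≡y (trans (cong (_⊕ -1# ⊗ y) (sym (*-identityˡ x))) eq)

  1⊗x⊕[-1⊗x]≡0 : ∀ {x y} → x ≡ y → 1# ⊗ x ⊕ -1# ⊗ y ≡ 0#
  1⊗x⊕[-1⊗x]≡0 {x} refl = trans (cong (_⊕ -1# ⊗ x) (*-identityˡ x)) (x⊕[-1⊗x]≡0 x)

  lin-injective : ∀ {r P Q} → Bounded P → Bounded Q → lin r P ≗ lin r Q → P ≗ Q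
  lin-injective {r} {P} {Q} bP bQ eq i = 1⊗x⊕[-1⊗y]≡0⇒x≡y (degLt-unlin (bounded-combine bP bQ) lin≡0 i z≤n)
    where
    lin≡0 : DegLt 1 (lin r (combine 1# P -1# Q))
    lin≡0 i _ = trans (lin-combine r 1# P -1# Q i) (1⊗x⊕[-1⊗x]≡0 (eq i))

  -- (X + r) ^ k divides P.
  Mult : Carrier → ℕ → Poly → Set c
  Mult r zero    P = Bounded P
  Mult r (suc k) P = ∃ λ V → Mult r k V × P ≗ lin r V

  mult-bounded : ∀ {r} k {P} → Mult r k P → Bounded P
  mult-bounded zero    b             = b
  mult-bounded (suc k) (V , mV , eq) with n , d ← bounded-lin (mult-bounded k mV) =
    n , degLt-resp (λ i → sym (eq i)) d

  mult-resp : ∀ {r} k {P Q} → P ≗ Q → Mult r k P → Mult r k Q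
  mult-resp zero    P≗Q (n , d)       = n , degLt-resp P≗Q d
  mult-resp (suc k) P≗Q (V , mV , eq) = V , mV , λ i → trans (sym (P≗Q i)) (eq i)

  mult-combine : ∀ {r} k {x P y Q} → Mult r k P → Mult r k Q → Mult r k (combine x P y Q)
  mult-combine zero mP mQ = bounded-combine mP mQ
  mult-combine {r} (suc k) {x} {_} {y} (U , mU , eqU) (V , mV , eqV) =
    combine x U y V , mult-combine k mU mV , λ i →
      trans (cong₂ (λ a b → x ⊗ a ⊕ y ⊗ b) (eqU i) (eqV i)) (sym (lin-combine r x U y V i))

  mult-lin : ∀ {r} k s {P} → Mult r k P → Mult r k (lin s P)
  mult-lin zero        s mP            = bounded-lin mP
  mult-lin {r} (suc k) s (V , mV , eq) =
    lin s V , mult-lin k s mV , λ i → trans (lin-cong s eq i) (lin-comm s r V i)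

  mult-weaken : ∀ {r k l P} → k ≤ l → Mult r l P → Mult r k P
  mult-weaken {l = l} z≤n       m             = mult-bounded l m
  mult-weaken         (s≤s k≤l) (V , mV , eq) = V , mult-weaken k≤l mV , eq

  mult-unlin : ∀ {r k V} → Bounded V → Mult r (suc k) (lin r V) → Mult r k V
  mult-unlin {k = k} bV (U , mU , eq) =
    mult-resp k (lin-injective (mult-bounded k mU) bV (λ i → sym (eq i))) mU

  -- Coprimality of X + r and X + s.
  mult-unlin-≢ : ∀ {r s} k {V} → r ≢ s → Bounded V → Mult s k (lin r V) → Mult s k V
  mult-unlin-≢ zero r≢s bV _ = bV
  mult-unlin-≢ {r} {s} (suc k) {V} r≢s bV (U , mU , eq) with d , ι , refl , ι⊗d≡1 ← difference r≢s =
    Y , mult-unlin-≢ k r≢s (bounded-combine (mult-bounded k mU) bV) (mult-resp k U≗lin mU) , V≗lin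
    where
    open ≡-Reasoning
    -- With r = s + d, the equation (X + r) V = (X + s) U reads d V = (X + s) (U - V), so the
    -- quotient of V by X + s is (U - V) / d. The same Y is the quotient of U by X + r.
    Y = combine ι U (ι ⊗ -1#) V

    recover : ∀ a b e → a ≡ b ⊕ d ⊗ e → ι ⊗ a ⊕ ι ⊗ -1# ⊗ b ≡ e
    recover a b e refl = begin
      ι ⊗ (b ⊕ d ⊗ e) ⊕ ι ⊗ -1# ⊗ b       ≡⟨ solve 5 (λ ι b d e n →
        ι :* (b :+ d :* e) :+ ι :* n :* b := ι :* (b :+ n :* b) :+ ι :* d :* e) refl ι b d e -1# ⟩
      ι ⊗ (b ⊕ -1# ⊗ b) ⊕ ι ⊗ d ⊗ e       ≡⟨ cong₂ (λ x y → ι ⊗ x ⊕ y ⊗ e) (x⊕[-1⊗x]≡0 b) ι⊗d≡1 ⟩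
      ι ⊗ 0# ⊕ 1# ⊗ e                     ≡⟨ cong₂ _⊕_ (zeroʳ ι) (*-identityˡ e) ⟩
      0# ⊕ e                              ≡⟨ +-identityˡ e ⟩
      e                                   ∎

    V≗lin : V ≗ lin s Y
    V≗lin i = sym (trans (lin-combine s ι U (ι ⊗ -1#) V i)
      (recover (lin s U i) (lin s V i) (V i) (trans (sym (eq i)) (lin-⊕ s d V i))))

    U≗lin : U ≗ lin (s ⊕ d) Y
    U≗lin i = sym (trans (lin-combine (s ⊕ d) ι U (ι ⊗ -1#) V i)
      (recover (lin (s ⊕ d) U i) (lin (s ⊕ d) V i) (U i)
        (trans (lin-⊕ s d U i) (cong (_⊕ d ⊗ U i) (sym (eq i))))))

  -- Linear factors are divided out one by one, each lowering the degree bound by one, while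
  -- coprimality keeps the multiplicities at the other roots. The bound reached, `DegLt 0 P`, means
  -- P = 0.
  mult-degree : ∀ (B : List Carrier) → Unique B → ∀ k {P} → DegLt (length B * k) P →
    (∀ {r} → r ∈ B → Mult r k P) → DegLt 0 P
  mult-degree []      _          k deg _ = deg
  mult-degree (r ∷ B) (r∉B ∷ uB) k deg m = peel k deg (m (here refl)) (λ s∈B → m (there s∈B))
    where
    peel : ∀ j {P} → DegLt (j + length B * k) P → Mult r j P → (∀ {s} → s ∈ B → Mult s k P) → DegLt 0 P
    peel zero    deg _             m = mult-degree B uB k deg m
    peel (suc j) deg (V , mV , eq) m i _ = trans (eq i) (trans (lin-cong r V≗0 i) (lin-0 i))
      where
      bV = mult-bounded j mV
      V≗0 : V ≗ λ _ → 0#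
      V≗0 i = peel j (degLt-unlin bV (degLt-resp eq deg)) mV
        (λ s∈B → mult-unlin-≢ k (All.lookup r∉B s∈B) bV (mult-resp k eq (m s∈B))) i z≤n
      lin-0 : lin r (λ _ → 0#) ≗ λ _ → 0#
      lin-0 zero    = zeroʳ r
      lin-0 (suc i) = 0⊕0 refl refl

  roots≤degree : ∀ (B : List Carrier) → Unique B → ∀ k {P n} → P n ≡ 1# → DegLt (suc n) P →
    (∀ {r} → r ∈ B → Mult r k P) → length B * k ≤ n
  roots≤degree B uB k {P} {n} monic deg mult with length B * k ℕ.≤? n
  ... | yes ≤n = ≤n
  ... | no  ≰n = ⊥-elim (1≢0 (trans (sym monic)
    (mult-degree B uB k (degLt-weaken (ℕ.≰⇒> ≰n) deg) mult n z≤n)))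

  -- The formal derivative.

  D : Poly → Poly
  D P i = (suc i · 1#) ⊗ P (suc i)

  -- The product rule, X + r having derivative 1.
  D-lin : ∀ r P → D (lin r P) ≗ combine 1# (lin r (D P)) 1# P
  D-lin r P zero = solve 3 (λ r a b → (con 1 :+ con 0) :* (a :+ r :* b) :=
    con 1 :* (r :* ((con 1 :+ con 0) :* b)) :+ con 1 :* a) refl r (P 0) (P 1)
  D-lin r P (suc i) = solve 4 (λ r n a b → (con 1 :+ n) :* (a :+ r :* b) :=
    con 1 :* (n :* a :+ r :* ((con 1 :+ n) :* b)) :+ con 1 :* a)
    refl r (suc i · 1#) (P (suc i)) (P (suc (suc i)))

  D-cong : ∀ {P Q} → P ≗ Q → D P ≗ D Q
  D-cong P≗Q i = cong ((suc i · 1#) ⊗_) (P≗Q (suc i))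

  degLt-D : ∀ {n P} → DegLt (suc n) P → DegLt n (D P)
  degLt-D d i n≤i = trans (cong ((suc i · 1#) ⊗_) (d (suc i) (s≤s n≤i))) (zeroʳ _)

  mult-D : ∀ {r} k {P} → Mult r (suc k) P → Mult r k (D P)
  mult-D zero m with n , d ← mult-bounded 1 m = n , degLt-D (degLt-weaken (ℕ.n≤1+n n) d)
  mult-D {r} (suc k) (V , mV , eq) =
    mult-resp (suc k) (λ i → sym (trans (D-cong eq i) (D-lin r V i)))
      (mult-combine (suc k) (D V , mult-D k mV , λ _ → refl) mV)

  -- Powers of linear factors, and division with remainder.

  one-degree : DegLt 1 one
  one-degree (suc i) _ = refl

  shift : Poly → Poly
  shift P zero    = 0#
  shift P (suc i) = P i

  shiftN : ℕ → Poly → Poly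
  shiftN zero    P = P
  shiftN (suc k) P = shift (shiftN k P)

  linN : Carrier → ℕ → Poly → Poly
  linN r zero    P = P
  linN r (suc k) P = lin r (linN r k P)

  bounded-linN : ∀ {r} k {P} → Bounded P → Bounded (linN r k P)
  bounded-linN zero    b = b
  bounded-linN (suc k) b = bounded-lin (bounded-linN k b)

  mult-linN : ∀ {r} k {P} → Bounded P → Mult r k (linN r k P)
  mult-linN zero    b = b
  mult-linN (suc k) b = _ , mult-linN k b , λ _ → refl

  mult-unlinN : ∀ {r} k l {P} → Bounded P → Mult r (k + l) (linN r k P) → Mult r l P
  mult-unlinN zero    l bP m = m
  mult-unlinN (suc k) l bP m = mult-unlinN k l bP (mult-unlin (bounded-linN k bP) m)

  mult-unlinN-≢ : ∀ {r s} k l {P} → r ≢ s → Bounded P → Mult s l (linN r k P) → Mult s l P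
  mult-unlinN-≢ zero    l r≢s bP m = m
  mult-unlinN-≢ (suc k) l r≢s bP m =
    mult-unlinN-≢ k l r≢s bP (mult-unlin-≢ l r≢s (bounded-linN k bP) m)

  linN-one-degree : ∀ r k → DegLt (suc k) (linN r k one)
  linN-one-degree r zero    = one-degree
  linN-one-degree r (suc k) = degLt-lin (linN-one-degree r k)

  linN-one-monic : ∀ r k → linN r k one k ≡ 1#
  linN-one-monic r zero    = refl
  linN-one-monic r (suc k) = trans
    (cong₂ (λ x y → x ⊕ r ⊗ y) (linN-one-monic r k) (linN-one-degree r k (suc k) ℕ.≤-refl))
    (trans (cong (1# ⊕_) (zeroʳ r)) (+-identityʳ 1#))

  D-linN-one : ∀ r k i → D (linN r (suc k) one) i ≡ (suc k · 1#) ⊗ linN r k one i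
  D-linN-one r zero zero = solve 1 (λ r →
    (con 1 :+ con 0) :* (con 1 :+ r :* con 0) := (con 1 :+ con 0) :* con 1) refl r
  D-linN-one r zero (suc i) = solve 2 (λ r n →
    (con 1 :+ n) :* (con 0 :+ r :* con 0) := (con 1 :+ con 0) :* con 0) refl r (suc i · 1#)
  D-linN-one r (suc k) i = begin
    D (lin r (linN r (suc k) one)) i
      ≡⟨ D-lin r (linN r (suc k) one) i ⟩
    1# ⊗ lin r (D (linN r (suc k) one)) i ⊕ 1# ⊗ linN r (suc k) one i
      ≡⟨ cong (λ x → 1# ⊗ x ⊕ 1# ⊗ linN r (suc k) one i)
              (trans (lin-cong r (D-linN-one r k) i) (lin-scale r (suc k · 1#) (linN r k one) i)) ⟩
    1# ⊗ ((suc k · 1#) ⊗ linN r (suc k) one i) ⊕ 1# ⊗ linN r (suc k) one i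
      ≡⟨ solve 2 (λ n a → con 1 :* (n :* a) :+ con 1 :* a := (con 1 :+ n) :* a)
               refl (suc k · 1#) (linN r (suc k) one i) ⟩
    (suc (suc k) · 1#) ⊗ linN r (suc k) one i
      ∎
    where
    open ≡-Reasoning
    lin-scale : ∀ r n P → lin r (λ i → n ⊗ P i) ≗ λ i → n ⊗ lin r P i
    lin-scale r n P zero    = solve 3 (λ r n a → r :* (n :* a) := n :* (r :* a)) refl r n (P 0)
    lin-scale r n P (suc i) = solve 4 (λ r n a b →
      n :* a :+ r :* (n :* b) := n :* (a :+ r :* b)) refl r n (P i) (P (suc i))

  linN-convolution-zero : ∀ r k P → linN r k P 0 ≡ P 0 ⊗ linN r k one 0
  linN-convolution-zero r zero    P = sym (*-identityʳ (P 0))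
  linN-convolution-zero r (suc k) P = trans (cong (r ⊗_) (linN-convolution-zero r k P))
    (solve 3 (λ r a b → r :* (a :* b) := a :* (r :* b)) refl r (P 0) (linN r k one 0))

  -- Linearity applied to P = P(0) + X P′. It lets a formula for (X + r)^k alone extend to (X + r)^k
  -- P by induction on the index.
  linN-convolution-suc : ∀ r k P i →
    linN r k P (suc i) ≡ P 0 ⊗ linN r k one (suc i) ⊕ linN r k (λ j → P (suc j)) i
  linN-convolution-suc r zero P i = sym (trans (cong (_⊕ P (suc i)) (zeroʳ (P 0))) (+-identityˡ _))
  linN-convolution-suc r (suc k) P zero = trans
    (cong₂ (λ x y → x ⊕ r ⊗ y) (linN-convolution-zero r k P) (linN-convolution-suc r k P 0))
    (solve 5 (λ r a b d e → a :* b :+ r :* (a :* d :+ e) := a :* (b :+ r :* d) :+ r :* e)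
      refl r (P 0) (linN r k one 0) (linN r k one 1) (linN r k (λ j → P (suc j)) 0))
  linN-convolution-suc r (suc k) P (suc i) = trans
    (cong₂ (λ x y → x ⊕ r ⊗ y) (linN-convolution-suc r k P i) (linN-convolution-suc r k P (suc i)))
    (solve 6 (λ r a b d e f → (a :* b :+ e) :+ r :* (a :* d :+ f) := a :* (b :+ r :* d) :+ (e :+ r :* f))
      refl r (P 0) (linN r k one (suc i)) (linN r k one (suc (suc i)))
      (linN r k (λ j → P (suc j)) i) (linN r k (λ j → P (suc j)) (suc i)))

  shiftN-convolution : ∀ k P i →
    shiftN k P i ≡ P 0 ⊗ shiftN k one i ⊕ shift (shiftN k (λ j → P (suc j))) i
  shiftN-convolution zero P zero    = sym (trans (+-identityʳ _) (*-identityʳ (P 0)))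
  shiftN-convolution zero P (suc i) = sym (trans (cong (_⊕ P (suc i)) (zeroʳ (P 0))) (+-identityˡ _))
  shiftN-convolution (suc k) P zero = sym (trans (+-identityʳ _) (zeroʳ (P 0)))
  shiftN-convolution (suc k) P (suc i) = shiftN-convolution k P i

  shiftN-< : ∀ {k i} P → i < k → shiftN k P i ≡ 0#
  shiftN-< {suc k} {zero}  P _         = refl
  shiftN-< {suc k} {suc i} P (s≤s i<k) = shiftN-< P i<k

  shiftN-+ : ∀ k P j → shiftN k P (k + j) ≡ P j
  shiftN-+ zero    P j = refl
  shiftN-+ (suc k) P j = shiftN-+ k P j

  -- Horner's scheme: if V = V(0) + X V′ and V′ = (X + r) U + x, then V = (X + r) (X U + x) + (V(0)
  -- - r x).
  divide : ∀ r n V → DegLt n V → ∃₂ λ U x → Bounded U × V ≗ (λ i → lin r U i ⊕ x ⊗ one i)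
  divide r zero V d = (λ _ → 0#) , 0# , (0 , λ _ _ → refl) , λ
    { zero    → trans (d 0 z≤n) (sym (solve 1 (λ r → r :* con 0 :+ con 0 :* con 1 := con 0) refl r))
    ; (suc i) → trans (d (suc i) z≤n)
        (sym (solve 1 (λ r → con 0 :+ r :* con 0 :+ con 0 :* con 0 := con 0) refl r)) }
  divide r (suc n) V d with U , x , (m , dU) , eq ← divide r n (λ i → V (suc i)) (λ i n≤i → d (suc i) (s≤s n≤i)) =
    U′ , V 0 ⊕ -1# ⊗ (r ⊗ x) , (suc m , λ { (suc i) (s≤s m≤i) → dU i m≤i }) , λ
    { zero    → sym (trans
        (solve 4 (λ r x v n → r :* x :+ (v :+ n :* (r :* x)) :* con 1 := v :+ (r :* x :+ n :* (r :* x))) refl r x (V 0) -1#)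
        (trans (cong (V 0 ⊕_) (x⊕[-1⊗x]≡0 (r ⊗ x))) (+-identityʳ (V 0))))
    ; (suc zero) → trans (eq 0)
        (solve 4 (λ r x u v → r :* u :+ x :* con 1 := x :+ r :* u :+ v :* con 0) refl r x (U 0) _)
    ; (suc (suc i)) → trans (eq (suc i))
        (solve 5 (λ r x a b v → a :+ r :* b :+ x :* con 0 := a :+ r :* b :+ v :* con 0) refl r x (U i) (U (suc i)) _) }
    where
    U′ : Poly
    U′ zero    = x
    U′ (suc i) = U i

-- Characteristic p and lacunary polynomials.

module Lacunary {c : Level} {q : ℕ} (F : FiniteField c q) (p′ : ℕ) (p-prime : Prime (suc p′))
  (char : Polynomials._·_ F (suc p′) (FiniteField.1# F) ≡ FiniteField.0# F) where
  open Polynomials F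

  p : ℕ
  p = suc p′

  multiple-char : ∀ k → (k * p) · 1# ≡ 0#
  multiple-char k = trans (×1-homo-* k p) (trans (cong ((k · 1#) ⊗_) char) (zeroʳ _))

  -- A Bézout identity between p and i, read in the field, would become 1 = 0.
  ∤⇒·1≢0 : ∀ {i} → p ∤ i → i · 1# ≢ 0#
  ∤⇒·1≢0 {i} p∤i i·1≡0 with coprime-Bézout coprime
    where
    coprime : Coprime p i
    coprime (d∣p , d∣i) with prime⇒irreducible p-prime d∣p
    ... | inj₁ d≡1 = d≡1
    ... | inj₂ d≡p = ⊥-elim (p∤i (subst (_∣ i) d≡p d∣i))
  ... | Bézout.+- x y eq = 1≢0 (begin
      1#                          ≡⟨ +-identityʳ 1# ⟨
      1# ⊕ 0#                     ≡⟨ cong (1# ⊕_) (trans (×1-homo-* y i) (trans (cong ((y · 1#) ⊗_) i·1≡0) (zeroʳ _))) ⟨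
      suc (y * i) · 1#            ≡⟨ cong (_· 1#) eq ⟩
      (x * p) · 1#                ≡⟨ multiple-char x ⟩
      0#                          ∎)
    where open ≡-Reasoning
  ... | Bézout.-+ x y eq = 1≢0 (begin
      1#                          ≡⟨ +-identityʳ 1# ⟨
      1# ⊕ 0#                     ≡⟨ cong (1# ⊕_) (multiple-char x) ⟨
      suc (x * p) · 1#            ≡⟨ cong (_· 1#) eq ⟩
      (y * i) · 1#                ≡⟨ trans (×1-homo-* y i) (trans (cong ((y · 1#) ⊗_) i·1≡0) (zeroʳ _)) ⟩
      0#                          ∎)
    where open ≡-Reasoning

  -- (X + b) ^ p = X ^ p + frob b
  frob : Carrier → Carrier
  frob b = linN b p one 0

  -- No binomial coefficients are needed: the derivative p (X + b)^(p - 1) is 0, and for 0 < i < p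
  -- the factor i in its coefficients is invertible, so the coefficient of X^i in (X + b)^p
  -- vanishes.
  linN-p-one : ∀ b i → linN b p one i ≡ shiftN p one i ⊕ frob b ⊗ one i
  linN-p-one b zero    = sym (trans (+-identityˡ _) (*-identityʳ (frob b)))
  linN-p-one b (suc i) = sym (trans (cong (shiftN p one (suc i) ⊕_) (zeroʳ (frob b))) (trans (+-identityʳ _) (sym middle)))
    where
    middle : linN b p one (suc i) ≡ shiftN p one (suc i)
    middle with suc i ℕ.<? p
    ... | yes i<p = trans (⊗-cancelˡ-0 (∤⇒·1≢0 (>⇒∤ i<p)) (trans (D-linN-one b p′ i) (trans (cong (_⊗ linN b p′ one i) char) (zeroˡ _))))
                          (sym (shiftN-< one i<p))
    ... | no  i≮p with j , refl ← ℕ.m≤n⇒∃[o]m+o≡n (ℕ.≮⇒≥ i≮p) = trans (top j) (sym (shiftN-+ p one j))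
      where
      top : ∀ j → linN b p one (p + j) ≡ one j
      top zero    = trans (cong (linN b p one) (ℕ.+-identityʳ p)) (linN-one-monic b p)
      top (suc j) = linN-one-degree b p (p + suc j) (ℕ.m<m+n p (s≤s z≤n))

  linN-p : ∀ b P i → linN b p P i ≡ shiftN p P i ⊕ frob b ⊗ P i
  linN-p b P zero = trans (linN-convolution-zero b p P)
    (solve 2 (λ a f → a :* f := con 0 :+ f :* a) refl (P 0) (frob b))
  linN-p b P (suc i) = begin
    linN b p P (suc i)
      ≡⟨ linN-convolution-suc b p P i ⟩
    P 0 ⊗ linN b p one (suc i) ⊕ linN b p (λ j → P (suc j)) i
      ≡⟨ cong₂ (λ x y → P 0 ⊗ x ⊕ y) (linN-p-one b (suc i)) (linN-p b (λ j → P (suc j)) i) ⟩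
    P 0 ⊗ (shiftN p one (suc i) ⊕ frob b ⊗ 0#) ⊕ (shiftN p (λ j → P (suc j)) i ⊕ frob b ⊗ P (suc i))
      ≡⟨ solve 5 (λ a s f t d → a :* (s :+ f :* con 0) :+ (t :+ f :* d) := (a :* s :+ t) :+ f :* d)
               refl (P 0) (shiftN p one (suc i)) (frob b) (shiftN p (λ j → P (suc j)) i) (P (suc i)) ⟩
    (P 0 ⊗ shiftN p one (suc i) ⊕ shiftN p (λ j → P (suc j)) i) ⊕ frob b ⊗ P (suc i)
      ≡⟨ cong (_⊕ frob b ⊗ P (suc i)) (shiftN-convolution p P (suc i)) ⟨
    shiftN p P (suc i) ⊕ frob b ⊗ P (suc i)
      ∎
    where open ≡-Reasoning

  -- V (X ^ p)
  expand : Poly → Poly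
  expand V i with p ∣? i
  ... | yes (divides k _) = V k
  ... | no  _             = 0#

  expand-* : ∀ V k → expand V (k * p) ≡ V k
  expand-* V k with p ∣? (k * p)
  ... | yes (divides l k*p≡l*p) = cong V (sym (ℕ.*-cancelʳ-≡ k l p k*p≡l*p))
  ... | no  p∤k*p               = ⊥-elim (p∤k*p (divides k refl))

  expand-∤ : ∀ V {i} → p ∤ i → expand V i ≡ 0#
  expand-∤ V {i} p∤i with p ∣? i
  ... | yes p∣i = ⊥-elim (p∤i p∣i)
  ... | no  _   = refl

  expand-cong : ∀ {U V} → U ≗ V → expand U ≗ expand V
  expand-cong U≗V i with p ∣? i
  ... | yes (divides k _) = U≗V k
  ... | no  _             = refl

  bounded-expand : ∀ {V} → Bounded V → Bounded (expand V)
  bounded-expand {V} (n , d) = n * p , vanish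
    where
    vanish : DegLt (n * p) (expand V)
    vanish i n*p≤i with p ∣? i
    ... | yes (divides k refl) = d k (ℕ.*-cancelʳ-≤ n k p n*p≤i)
    ... | no  _                = refl

  -- Substituting X^p turns X + b^p into (X + b)^p, so a division by X + b^p becomes one by (X +
  -- b)^p with the same constant remainder.
  expand-lin : ∀ b V x → expand (λ i → lin (frob b) V i ⊕ x ⊗ one i) ≗ λ i → linN b p (expand V) i ⊕ x ⊗ one i
  expand-lin b V x i with p ∣? i
  ... | yes (divides zero refl) = cong (_⊕ x ⊗ 1#) (sym (trans (linN-p b (expand V) 0)
          (trans (+-identityˡ _) (cong (frob b ⊗_) (expand-* V 0)))))
  ... | yes (divides (suc k) refl) = cong (_⊕ x ⊗ 0#) (sym (trans (linN-p b (expand V) (p + k * p))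
          (cong₂ (λ s t → s ⊕ frob b ⊗ t) (trans (shiftN-+ p (expand V) (k * p)) (expand-* V k)) (expand-* V (suc k)))))
  ... | no p∤i = sym (trans (cong₂ _⊕_ (trans (linN-p b (expand V) i) (0⊕0 shifted (expand-∤ V p∤i)))
                                       (trans (cong (x ⊗_) (one-∤ p∤i)) (zeroʳ x))) (+-identityˡ 0#))
    where
    one-∤ : ∀ {i} → p ∤ i → one i ≡ 0#
    one-∤ {zero}  p∤0 = ⊥-elim (p∤0 (divides 0 refl))
    one-∤ {suc i} _   = refl
    shifted : shiftN p (expand V) i ≡ 0#
    shifted with i ℕ.<? p
    ... | yes i<p = shiftN-< (expand V) i<p
    ... | no  i≮p with j , refl ← ℕ.m≤n⇒∃[o]m+o≡n (ℕ.≮⇒≥ i≮p) =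
      trans (shiftN-+ p (expand V) j) (expand-∤ V λ p∣j → p∤i (∣m∣n⇒∣m+n (divides 1 (sym (ℕ.*-identityˡ p))) p∣j))

  -- The constant x equals (X + r) (U - P), and comparing degrees gives U = P.
  remainder-zero : ∀ {r P x} → Bounded P → Mult r 1 (λ i → lin r P i ⊕ x ⊗ one i) → x ≡ 0#
  remainder-zero {r} {P} {x} bP (U , bU , eq) = begin
    x              ≡⟨ *-identityʳ x ⟨
    x ⊗ 1#         ≡⟨ lin-G 0 ⟨
    r ⊗ G 0        ≡⟨ cong (r ⊗_) (degLt-unlin bG constant 0 z≤n) ⟩
    r ⊗ 0#         ≡⟨ zeroʳ r ⟩
    0#             ∎
    where
    open ≡-Reasoning
    G = combine 1# U -1# P
    bG = bounded-combine bU bP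
    lin-G : ∀ i → lin r G i ≡ x ⊗ one i
    lin-G i = begin
      lin r G i                                             ≡⟨ lin-combine r 1# U -1# P i ⟩
      1# ⊗ lin r U i ⊕ -1# ⊗ lin r P i                      ≡⟨ cong (λ y → 1# ⊗ y ⊕ -1# ⊗ lin r P i) (eq i) ⟨
      1# ⊗ (lin r P i ⊕ x ⊗ one i) ⊕ -1# ⊗ lin r P i        ≡⟨ solve 3 (λ a b n →
        con 1 :* (a :+ b) :+ n :* a := (a :+ n :* a) :+ b) refl (lin r P i) (x ⊗ one i) -1# ⟩
      (lin r P i ⊕ -1# ⊗ lin r P i) ⊕ x ⊗ one i             ≡⟨ cong (_⊕ x ⊗ one i) (x⊕[-1⊗x]≡0 (lin r P i)) ⟩
      0# ⊕ x ⊗ one i                                        ≡⟨ +-identityˡ _ ⟩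
      x ⊗ one i                                             ∎
    constant : DegLt 1 (lin r G)
    constant (suc i) _ = trans (lin-G (suc i)) (zeroʳ x)

  -- Otherwise X + b divides (X + a)^p with a ≢ b, and cancelling the coprime factors makes it
  -- divide 1.
  frob-injective : ∀ {a b} → frob a ≡ frob b → a ≡ b
  frob-injective {a} {b} eq with a ≟ b
  ... | yes a≡b = a≡b
  ... | no  a≢b = ⊥-elim (no-root-one (mult-unlinN-≢ p 1 a≢b (1 , one-degree)
      (mult-resp 1 same (mult-weaken {l = p} (s≤s z≤n) (mult-linN p (1 , one-degree))))))
    where
    same : linN b p one ≗ linN a p one
    same i = trans (linN-p-one b i) (trans
      (cong (λ f → shiftN p one i ⊕ f ⊗ one i) (sym eq)) (sym (linN-p-one a i)))
    no-root-one : ¬ Mult b 1 one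
    no-root-one (V , bV , one≗) = 1≢0 (trans (one≗ 0)
      (trans (cong (b ⊗_) (degLt-unlin bV (degLt-resp one≗ one-degree) 0 z≤n)) (zeroʳ b)))

  -- Roots of V(X^p) come with multiplicities divisible by p, so k p + 1 counts as (k + 1) p. A root
  -- at -b makes the remainder of V modulo X + b^p vanish; then (X + b)^p is cancelled and the
  -- argument repeats on the quotient.
  descend : ∀ {b} k V → Bounded V → Mult b (k * p + 1) (expand V) → Mult (frob b) (suc k) V
  descend {b} k V (n , d) m with divide (frob b) n V d
  ... | U , x , bU , V≗ = U , quotient k m , V≗lin
    where
    expandV≗ : ∀ i → expand V i ≡ linN b p (expand U) i ⊕ x ⊗ one i
    expandV≗ i = trans (expand-cong V≗ i) (expand-lin b U x i)

    x≡0 : x ≡ 0#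
    x≡0 = remainder-zero (bounded-linN p′ (bounded-expand bU))
      (mult-weaken (ℕ.m≤n+m 1 (k * p)) (mult-resp (k * p + 1) expandV≗ m))

    +0⊗ : ∀ a e → a ⊕ x ⊗ e ≡ a
    +0⊗ a e = trans (cong (a ⊕_) (trans (cong (_⊗ e) x≡0) (zeroˡ e))) (+-identityʳ a)

    V≗lin : V ≗ lin (frob b) U
    V≗lin i = trans (V≗ i) (+0⊗ _ _)

    quotient : ∀ k → Mult b (k * p + 1) (expand V) → Mult (frob b) k U
    quotient zero    _ = bU
    quotient (suc k) m = descend k U bU (mult-unlinN p (k * p + 1) (bounded-expand bU)
      (mult-resp (p + (k * p + 1)) (λ i → trans (expandV≗ i) (+0⊗ _ _))
        (subst (λ j → Mult b j (expand V)) (ℕ.+-assoc p (k * p) 1) m)))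

  -- If X ^ (p ^ k) + (terms of degree at most e) has n roots of multiplicity m
  -- and is a polynomial in X ^ (p ^ s) but not in X ^ (p ^ (s + 1)), then
  -- dividing exponents by p ^ s and differentiating leaves a non-zero
  -- polynomial with n roots of multiplicity ⌈ m / p ^ s ⌉ - 1.
  lacunary : ∀ k {W} e (B : List Carrier) → Unique B → 2 ≤ length B → ∀ m →
    W (p ^ k) ≡ 1# → DegLt (suc (p ^ k)) W → (∀ i → e < i → i < p ^ k → W i ≡ 0#) →
    (∀ {r} → r ∈ B → Mult r (suc m) W) →
    ∃ λ s → p ^ s * length B ≤ p ^ k × suc m * length B ≤ e + p ^ s * (length B ∸ 1)
  -- The degree is p^0 = 1, which leaves no room for two roots.
  lacunary zero e B uB 2≤n m monic deg gap mult = ⊥-elim (ℕ.<⇒≱ 2≤n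
    (ℕ.≤-trans (ℕ.m≤m*n (length B) (suc m)) (roots≤degree B uB (suc m) monic deg mult)))
  lacunary (suc k) {W} e B uB 2≤n m monic deg gap mult
    -- A non-zero coefficient at an exponent prime to p makes the derivative non-zero, and s = 0
    -- works. If there is none, W is a polynomial in X^p.
    with ℕ.anyUpTo? (λ i → ¬? (p ∣? i) ×-dec ¬? (W i ≟ 0#)) (p ^ suc k)
  ... | yes (zero  , _   , p∤0 , _) = ⊥-elim (p∤0 (divides 0 refl))
  ... | yes (suc i , i<Q , p∤i , Wi≢0) = 0 , p^0*n≤Q , m*n≤
    where
    n = length B

    p^0*n≤Q : 1 * n ≤ p ^ suc k
    p^0*n≤Q = subst (_≤ p ^ suc k) (sym (ℕ.*-identityˡ n)) (ℕ.≤-trans (ℕ.m≤m*n n (suc m)) (roots≤degree B uB (suc m) monic deg mult))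

    -- The leading exponent is divisible by p, so its term has derivative 0; the others have
    -- exponent at most e.
    degD : DegLt e (D W)
    degD j e≤j with ℕ.<-cmp (suc j) (p ^ suc k)
    ... | tri< j<Q _ _ = trans (cong ((suc j · 1#) ⊗_) (gap (suc j) (s≤s e≤j) j<Q)) (zeroʳ _)
    ... | tri≈ _ j≡Q _ = trans (cong (_⊗ W (suc j)) (trans
      (cong (_· 1#) (trans j≡Q (ℕ.*-comm p (p ^ k)))) (multiple-char (p ^ k)))) (zeroˡ _)
    ... | tri> _ _ j>Q = trans (cong ((suc j · 1#) ⊗_) (deg (suc j) j>Q)) (zeroʳ _)

    -- Otherwise the derivative has too many roots and vanishes, against the coefficient found at i
    -- + 1.
    n*m<e : n * m < e
    n*m<e with n * m ℕ.<? e
    ... | yes n*m<e = n*m<e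
    ... | no  n*m≮e = ⊥-elim (Wi≢0 (⊗-cancelˡ-0 (∤⇒·1≢0 p∤i)
      (mult-degree B uB m (degLt-weaken (ℕ.≮⇒≥ n*m≮e) degD) (λ r∈B → mult-D m (mult r∈B)) i z≤n)))

    open ℕ.≤-Reasoning
    m*n≤ : suc m * n ≤ e + 1 * (n ∸ 1)
    m*n≤ = begin
      n + m * n                 ≡⟨ cong (_+ m * n) (ℕ.m+[n∸m]≡n (ℕ.≤-trans (s≤s z≤n) 2≤n)) ⟨
      suc (n ∸ 1) + m * n       ≡⟨ ℕ.+-suc (n ∸ 1) (m * n) ⟨
      (n ∸ 1) + suc (m * n)     ≡⟨ ℕ.+-comm (n ∸ 1) (suc (m * n)) ⟩
      suc (m * n) + (n ∸ 1)     ≡⟨ cong (λ x → suc x + (n ∸ 1)) (ℕ.*-comm m n) ⟩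
      suc (n * m) + (n ∸ 1)     ≤⟨ ℕ.+-monoˡ-≤ (n ∸ 1) n*m<e ⟩
      e + (n ∸ 1)               ≡⟨ cong (λ x → e + x) (ℕ.*-identityˡ (n ∸ 1)) ⟨
      e + 1 * (n ∸ 1)           ∎
  ... | no  none = suc s , p^[1+s]*n≤Q , m*n≤
    where
    n = length B

    V : Poly
    V i = W (i * p)

    W≗expandV : W ≗ expand V
    W≗expandV i with p ∣? i
    ... | yes (divides _ i≡k*p) = cong W i≡k*p
    ... | no  p∤i with ℕ.<-cmp i (p ^ suc k)
    ... | tri≈ _ refl _ = ⊥-elim (p∤i (divides (p ^ k) (ℕ.*-comm p (p ^ k))))
    ... | tri> _ _ i>Q  = deg i i>Q
    ... | tri< i<Q _ _ with W i ≟ 0#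
    ...   | yes Wi≡0 = Wi≡0
    ...   | no  Wi≢0 = ⊥-elim (none (i , i<Q , p∤i , Wi≢0))

    -- `suc m′` is (m + 1) / p rounded up, the multiplicity that `descend` supplies, and `e′` is e /
    -- p rounded down. Both roundings go in the direction in which multiplying the recursive bound
    -- by p gives back the bound for m and e.
    m′ = m / p
    e′ = e / p
    n′ = length (map frob B)

    n′≡n : n′ ≡ n
    n′≡n = length-map frob B

    n≤p*n : ∀ x → x < suc (x / p) * p
    n≤p*n x = subst (_< suc (x / p) * p) (sym (m≡m%n+[m/n]*n x p)) (ℕ.+-monoˡ-< (x / p * p) (m%n<n x p))

    degV : DegLt (suc (p ^ k)) V
    degV i Q<i = deg (i * p) (subst (_< i * p) (ℕ.*-comm (p ^ k) p) (ℕ.*-monoˡ-< p Q<i))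

    gapV : ∀ i → e′ < i → i < p ^ k → V i ≡ 0#
    gapV i e′<i i<Q = gap (i * p) (ℕ.<-≤-trans (n≤p*n e) (ℕ.*-monoˡ-≤ p e′<i))
      (subst (i * p <_) (ℕ.*-comm (p ^ k) p) (ℕ.*-monoˡ-< p i<Q))

    m′*p+1≤1+m : m′ * p + 1 ≤ suc m
    m′*p+1≤1+m = subst (_≤ suc m) (ℕ.+-comm 1 (m′ * p)) (s≤s (m/n*n≤m m p))

    multV : ∀ {r} → r ∈ map frob B → Mult r (suc m′) V
    multV r∈ with b , b∈B , refl ← ∈-map⁻ frob r∈ = descend m′ V (suc (p ^ k) , degV)
      (mult-resp (m′ * p + 1) W≗expandV (mult-weaken m′*p+1≤1+m (mult b∈B)))

    rec = lacunary k e′ (map frob B) (map⁺ frob-injective uB) (subst (2 ≤_) (sym n′≡n) 2≤n) m′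
      (trans (cong W (ℕ.*-comm (p ^ k) p)) monic) degV gapV multV
    s = proj₁ rec

    open ℕ.≤-Reasoning
    p^[1+s]*n≤Q : p ^ suc s * n ≤ p ^ suc k
    p^[1+s]*n≤Q = begin
      p * p ^ s * n      ≡⟨ ℕ.*-assoc p (p ^ s) n ⟩
      p * (p ^ s * n)    ≡⟨ cong (λ x → p * (p ^ s * x)) n′≡n ⟨
      p * (p ^ s * n′)   ≤⟨ ℕ.*-monoʳ-≤ p (proj₁ (proj₂ rec)) ⟩
      p * p ^ k          ∎

    m*n≤ : suc m * n ≤ e + p ^ suc s * (n ∸ 1)
    m*n≤ = begin
      suc m * n                            ≤⟨ ℕ.*-monoˡ-≤ n (n≤p*n m) ⟩
      suc m′ * p * n                       ≡⟨ cong (_* n) (ℕ.*-comm (suc m′) p) ⟩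
      p * suc m′ * n                       ≡⟨ ℕ.*-assoc p (suc m′) n ⟩
      p * (suc m′ * n)                     ≡⟨ cong (λ x → p * (suc m′ * x)) n′≡n ⟨
      p * (suc m′ * n′)                    ≤⟨ ℕ.*-monoʳ-≤ p (proj₂ (proj₂ rec)) ⟩
      p * (e′ + p ^ s * (n′ ∸ 1))          ≡⟨ cong (λ x → p * (e′ + p ^ s * (x ∸ 1))) n′≡n ⟩
      p * (e′ + p ^ s * (n ∸ 1))           ≡⟨ ℕ.*-distribˡ-+ p e′ (p ^ s * (n ∸ 1)) ⟩
      p * e′ + p * (p ^ s * (n ∸ 1))       ≡⟨ cong₂ _+_ (ℕ.*-comm p e′) (sym (ℕ.*-assoc p (p ^ s) (n ∸ 1))) ⟩
      e′ * p + p ^ suc s * (n ∸ 1)         ≤⟨ ℕ.+-monoˡ-≤ _ (m/n*n≤m e p) ⟩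
      e + p ^ suc s * (n ∸ 1)              ∎

-- Counting in lists without repetitions.

module _ {a} {A : Set a} where

  length-⊆ : ∀ {xs ys : List A} → Unique xs → (∀ {x} → x ∈ xs → x ∈ ys) → length xs ≤ length ys
  length-⊆ {[]} _ _ = z≤n
  length-⊆ {x ∷ xs} {ys} (x∉xs ∷ u) xs⊆ys with us , vs , refl ← ∈-∃++ (xs⊆ys (here refl)) =
    subst (suc (length xs) ≤_) (sym length-ys) (s≤s (length-⊆ u xs⊆us++vs))
    where
    length-ys : length (us ++ x ∷ vs) ≡ suc (length (us ++ vs))
    length-ys = trans (length-++ us) (trans (ℕ.+-suc (length us) (length vs)) (cong suc (sym (length-++ us))))
    xs⊆us++vs : ∀ {y} → y ∈ xs → y ∈ us ++ vs
    xs⊆us++vs y∈xs with ∈-++⁻ us (xs⊆ys (there y∈xs))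
    ... | inj₁ y∈us         = ∈-++⁺ˡ y∈us
    ... | inj₂ (here refl)  = ⊥-elim (All.lookup x∉xs y∈xs refl)
    ... | inj₂ (there y∈vs) = ∈-++⁺ʳ us y∈vs

  unique-map-on : ∀ {b} {B : Set b} {f : A → B} {xs} → Unique xs →
    (∀ {x y} → x ∈ xs → y ∈ xs → f x ≡ f y → x ≡ y) → Unique (map f xs)
  unique-map-on []            _   = []
  unique-map-on {f = f} {x ∷ xs} (x∉xs ∷ u) inj = All.tabulate fx∉ ∷ unique-map-on u (λ x∈ y∈ → inj (there x∈) (there y∈))
    where
    fx∉ : ∀ {z} → z ∈ map f xs → f x ≢ z
    fx∉ z∈ fx≡z with y , y∈xs , refl ← ∈-map⁻ f z∈ = All.lookup x∉xs y∈xs (inj (here refl) (there y∈xs) fx≡z)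

  length-cartesianProduct : ∀ {b} {B : Set b} (xs : List A) (ys : List B) →
    length (cartesianProduct xs ys) ≡ length xs * length ys
  length-cartesianProduct []       ys = refl
  length-cartesianProduct (x ∷ xs) ys = trans (length-++ (map (x ,_) ys))
    (cong₂ _+_ (length-map (x ,_) ys) (length-cartesianProduct xs ys))

  member : ∀ {xs : List A} {n} → suc n ≤ length xs → ∃ λ x → x ∈ xs
  member {x ∷ _} _ = x , here refl

  distinct-pair : ∀ {xs : List A} → Unique xs → 2 ≤ length xs → ∃₂ λ x y → x ∈ xs × y ∈ xs × x ≢ y
  distinct-pair {x ∷ y ∷ _} ((x≢y ∷ _) ∷ _) _ = x , y , here refl , there (here refl) , x≢y
  distinct-pair {_ ∷ []} _ (s≤s ())

-- The characteristic of the field, and x^q = x.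

module Elements {c : Level} {q : ℕ} (F : FiniteField c q) where
  open Polynomials F
  open CommutativeRing commutativeRing using (+-assoc; *-assoc; +-isCommutativeMonoid; *-isCommutativeMonoid)
  open RingProperties ring using (+-cancelʳ; +-cancelˡ)
  open SemiringExp semiring public renaming (_^_ to infixr 8 _↑_) using ()
  open Inverse enumeration using (to; from; strictlyInverseˡ; strictlyInverseʳ)

  elements : List Carrier
  elements = map from (allFin q)

  ∈-elements : ∀ x → x ∈ elements
  ∈-elements x = subst (_∈ elements) (strictlyInverseʳ x) (∈-map⁺ from (∈-allFin (to x)))

  elements-unique : Unique elements
  elements-unique = map⁺ (λ {i} {j} eq → trans (sym (strictlyInverseˡ i)) (trans (cong to eq) (strictlyInverseˡ j))) (allFin⁺ q)

  length-elements : length elements ≡ q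
  length-elements = trans (length-map from (allFin q)) (length-tabulate (λ i → i))

  private
    same-elements⇒↭ : ∀ {xs ys : List Carrier} → Unique xs → Unique ys →
      (∀ {x} → x ∈ xs → x ∈ ys) → (∀ {x} → x ∈ ys → x ∈ xs) → xs ↭ ys
    same-elements⇒↭ u v f g = ∼bag⇒↭ (unique∧set⇒bag u v (mk⇔ f g))

    sum product : List Carrier → Carrier
    sum     = foldr _⊕_ 0#
    product = foldr _⊗_ 1#

  -- Translation by 1 permutes the elements, so their sum is unchanged although q · 1 has been added
  -- to it.
  q·1≡0 : q · 1# ≡ 0#
  q·1≡0 = +-cancelʳ (sum elements) (q · 1#) 0# (begin
    q · 1# ⊕ sum elements                 ≡⟨ cong (λ n → n · 1# ⊕ sum elements) length-elements ⟨
    length elements · 1# ⊕ sum elements   ≡⟨ sum-translate elements ⟨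
    sum (map (1# ⊕_) elements)            ≡⟨ foldr-commMonoid (setoid Carrier) +-isCommutativeMonoid (↭⇒↭ₛ translate) ⟩
    sum elements                          ≡⟨ +-identityˡ _ ⟨
    0# ⊕ sum elements                     ∎)
    where
    open ≡-Reasoning
    sum-translate : ∀ xs → sum (map (1# ⊕_) xs) ≡ length xs · 1# ⊕ sum xs
    sum-translate []       = sym (+-identityˡ 0#)
    sum-translate (x ∷ xs) = trans (cong ((1# ⊕ x) ⊕_) (sum-translate xs))
      (solve 3 (λ x n s → (con 1 :+ x) :+ (n :+ s) := (con 1 :+ n) :+ (x :+ s)) refl x (length xs · 1#) (sum xs))
    translate : map (1# ⊕_) elements ↭ elements
    translate = same-elements⇒↭ (map⁺ (+-cancelˡ 1# _ _) elements-unique) elements-unique (λ _ → ∈-elements _)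
      (λ {x} _ → subst (_∈ _) (trans (sym (+-assoc 1# -1# x)) (trans (cong (_⊕ x) (-‿inverseʳ 1#)) (+-identityˡ x)))
        (∈-map⁺ (1# ⊕_) (∈-elements (-1# ⊕ x))))

  prime-char : ∀ p h → q ≡ p ^ h → p · 1# ≡ 0#
  prime-char p h q≡p^h = reduce h (subst (λ n → n · 1# ≡ 0#) q≡p^h q·1≡0)
    where
    reduce : ∀ h → (p ^ h) · 1# ≡ 0# → p · 1# ≡ 0#
    reduce zero    1·1≡0 = ⊥-elim (1≢0 (trans (sym (+-identityʳ 1#)) 1·1≡0))
    reduce (suc h) eq with (p · 1#) ≟ 0#
    ... | yes p·1≡0 = p·1≡0
    ... | no  p·1≢0 = reduce h (⊗-cancelˡ-0 p·1≢0 (trans (sym (×1-homo-* p (p ^ h))) eq))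

  private
    units : List Carrier
    units = filter (λ x → ¬? (x ≟ 0#)) elements

    units-unique : Unique units
    units-unique = filter⁺ _ elements-unique

    ∈-units : ∀ {x} → x ≢ 0# → x ∈ units
    ∈-units x≢0 = ∈-filter⁺ _ (∈-elements _) x≢0

    ∈-units⁻ : ∀ {x} → x ∈ units → x ≢ 0#
    ∈-units⁻ x∈ = proj₂ (∈-filter⁻ _ {xs = elements} x∈)

    q≡1+units : q ≡ suc (length units)
    q≡1+units = trans (sym length-elements) (↭-length (same-elements⇒↭ elements-unique
      (All.tabulate (λ x∈ 0≡x → ∈-units⁻ x∈ (sym 0≡x)) ∷ units-unique) split (λ _ → ∈-elements _)))
      where
      split : ∀ {x} → x ∈ elements → x ∈ 0# ∷ units
      split {x} _ with x ≟ 0#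
      ... | yes x≡0 = here x≡0
      ... | no  x≢0 = there (∈-units x≢0)

    -- Multiplication by x permutes the units; their product is unchanged, non-zero, and can be
    -- cancelled.
    unit-power : ∀ {x} → x ≢ 0# → x ↑ length units ≡ 1#
    unit-power {x} x≢0 with ι , ι⊗x≡1 ← inverse x≢0 = x⊕[-1⊗y]≡0⇒x≡y
      (⊗-cancelˡ-0 (product≢0 units (λ u∈ → ∈-units⁻ u∈)) (begin
        product units ⊗ (x ↑ length units ⊕ -1# ⊗ 1#)
          ≡⟨ solve 3 (λ π y n → π :* (y :+ n :* con 1) := y :* π :+ n :* π) refl (product units) (x ↑ length units) -1# ⟩
        x ↑ length units ⊗ product units ⊕ -1# ⊗ product units
          ≡⟨ cong (_⊕ -1# ⊗ product units) (trans (sym (product-scale units))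
               (foldr-commMonoid (setoid Carrier) *-isCommutativeMonoid (↭⇒↭ₛ scale))) ⟩
        product units ⊕ -1# ⊗ product units
          ≡⟨ x⊕[-1⊗x]≡0 (product units) ⟩
        0# ∎))
      where
      open ≡-Reasoning
      nonzero-⊗ : ∀ {y z} → y ≢ 0# → z ≢ 0# → y ⊗ z ≢ 0#
      nonzero-⊗ y≢0 z≢0 yz≡0 = z≢0 (⊗-cancelˡ-0 y≢0 yz≡0)
      product≢0 : ∀ us → (∀ {u} → u ∈ us → u ≢ 0#) → product us ≢ 0#
      product≢0 []       _   = 1≢0
      product≢0 (u ∷ us) ≢0s = nonzero-⊗ (≢0s (here refl)) (product≢0 us (λ u∈ → ≢0s (there u∈)))
      product-scale : ∀ us → product (map (x ⊗_) us) ≡ x ↑ length us ⊗ product us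
      product-scale []       = sym (*-identityˡ 1#)
      product-scale (u ∷ us) = trans (cong ((x ⊗ u) ⊗_) (product-scale us))
        (solve 4 (λ x u y π → (x :* u) :* (y :* π) := (x :* y) :* (u :* π)) refl x u (x ↑ length us) (product us))
      ι[x[y]]≡y : ∀ y → ι ⊗ (x ⊗ y) ≡ y
      ι[x[y]]≡y y = trans (sym (*-assoc ι x y)) (trans (cong (_⊗ y) ι⊗x≡1) (*-identityˡ y))
      x[ι[y]]≡y : ∀ y → x ⊗ (ι ⊗ y) ≡ y
      x[ι[y]]≡y y = trans (solve 3 (λ x ι y → x :* (ι :* y) := ι :* (x :* y)) refl x ι y) (ι[x[y]]≡y y)
      ι≢0 : ι ≢ 0#
      ι≢0 refl = 1≢0 (trans (sym ι⊗x≡1) (zeroˡ x))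
      scale : map (x ⊗_) units ↭ units
      scale = same-elements⇒↭
        (map⁺ (λ {y} {z} eq → trans (sym (ι[x[y]]≡y y)) (trans (cong (ι ⊗_) eq) (ι[x[y]]≡y z))) units-unique)
        units-unique
        (λ z∈ → let y , y∈ , z≡ = ∈-map⁻ (x ⊗_) z∈ in subst (_∈ units) (sym z≡) (∈-units (nonzero-⊗ x≢0 (∈-units⁻ y∈))))
        (λ {z} z∈ → subst (_∈ _) (x[ι[y]]≡y z) (∈-map⁺ (x ⊗_) (∈-units (nonzero-⊗ ι≢0 (∈-units⁻ z∈)))))

  x↑q≡x : ∀ x → x ↑ q ≡ x
  x↑q≡x x = trans (cong (x ↑_) q≡1+units) power
    where
    power : x ⊗ x ↑ length units ≡ x
    power with x ≟ 0#
    ... | yes refl = zeroˡ _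
    ... | no  x≢0  = trans (cong (x ⊗_) (unit-power x≢0)) (*-identityʳ x)

-- Polynomial functions of the slope.

module PolynomialFunctions {c : Level} {q : ℕ} (F : FiniteField c q) where
  open Polynomials F

  -- f is given by a polynomial of degree < j, in Horner form.
  PolyLt : ℕ → (Carrier → Carrier) → Set c
  PolyLt zero    f = ∀ y → f y ≡ 0#
  PolyLt (suc j) f = ∃₂ λ a g → PolyLt j g × (∀ y → f y ≡ a ⊕ y ⊗ g y)

  polyLt-resp : ∀ j {f g} → (∀ y → f y ≡ g y) → PolyLt j f → PolyLt j g
  polyLt-resp zero    f≗g f≗0            y = trans (sym (f≗g y)) (f≗0 y)
  polyLt-resp (suc j) f≗g (a , h , p , eq) = a , h , p , λ y → trans (sym (f≗g y)) (eq y)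

  polyLt-0 : ∀ j {f} → (∀ y → f y ≡ 0#) → PolyLt j f
  polyLt-0 zero    f≗0 = f≗0
  polyLt-0 (suc j) f≗0 = 0# , (λ _ → 0#) , polyLt-0 j (λ _ → refl) , λ y →
    trans (f≗0 y) (solve 1 (λ y → con 0 := con 0 :+ y :* con 0) refl y)

  polyLt-combine : ∀ j x z {f g} → PolyLt j f → PolyLt j g → PolyLt j (λ y → x ⊗ f y ⊕ z ⊗ g y)
  polyLt-combine zero    x z f≗0 g≗0 y = 0⊗0 (f≗0 y) (g≗0 y)
  polyLt-combine (suc j) x z (a , f , pf , eqf) (b , g , pg , eqg) =
    x ⊗ a ⊕ z ⊗ b , (λ y → x ⊗ f y ⊕ z ⊗ g y) , polyLt-combine j x z pf pg , λ y →
      trans (cong₂ (λ s t → x ⊗ s ⊕ z ⊗ t) (eqf y) (eqg y))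
        (solve 7 (λ x z a b y s t → x :* (a :+ y :* s) :+ z :* (b :+ y :* t) :=
          (x :* a :+ z :* b) :+ y :* (x :* s :+ z :* t)) refl x z a b y (f y) (g y))

  polyLt-suc : ∀ j {f} → PolyLt j f → PolyLt (suc j) f
  polyLt-suc zero    f≗0             = polyLt-0 1 f≗0
  polyLt-suc (suc j) (a , g , p , eq) = a , g , polyLt-suc j p , eq

  polyLt-≤ : ∀ {j k f} → j ≤ k → PolyLt j f → PolyLt k f
  polyLt-≤ {k = k}     z≤n       f≗0             = polyLt-0 k f≗0
  polyLt-≤             (s≤s j≤k) (a , g , p , eq) = a , g , polyLt-≤ j≤k p , eq

  polyLt-var : ∀ j {f} → PolyLt j f → PolyLt (suc j) (λ y → y ⊗ f y)
  polyLt-var j {f} p = 0# , f , p , λ y → sym (+-identityˡ _)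

  -- The truncation of `pred` at j = 0 is harmless: f is then zero, and so is the product.
  polyLt-linear : ∀ j a b {f} → PolyLt (pred j) f → PolyLt j (λ y → (b ⊕ y ⊗ a) ⊗ f y)
  polyLt-linear zero    a b f≗0 y = trans (cong ((b ⊕ y ⊗ a) ⊗_) (f≗0 y)) (zeroʳ _)
  polyLt-linear (suc j) a b {f} p = polyLt-resp (suc j)
    (λ y → solve 4 (λ a b y f → b :* f :+ a :* (y :* f) := (b :+ y :* a) :* f) refl a b y (f y))
    (polyLt-combine (suc j) b a (polyLt-suc j p) (polyLt-var j p))

  -- The asymmetric bounds, at most j for f and below l for g, add up without a correction and allow
  -- l = 0.
  polyLt-* : ∀ j l {f g} → PolyLt (suc j) f → PolyLt l g → PolyLt (j + l) (λ y → f y ⊗ g y)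
  polyLt-* zero l {f} {g} (a , h , h≗0 , eq) pg = polyLt-resp l
    (λ y → trans (solve 3 (λ a g y → a :* g :+ con 0 :* g := (a :+ y :* con 0) :* g) refl a (g y) y)
      (cong (_⊗ g y) (sym (trans (eq y) (cong (λ z → a ⊕ y ⊗ z) (h≗0 y))))))
    (polyLt-combine l a 0# pg pg)
  polyLt-* (suc j) l {f} {g} (a , h , ph , eq) pg = polyLt-resp (suc (j + l))
    (λ y → trans (solve 4 (λ a g y h → a :* g :+ con 1 :* (y :* (h :* g)) := (a :+ y :* h) :* g) refl a (g y) y (h y))
      (cong (_⊗ g y) (sym (eq y))))
    (polyLt-combine (suc (j + l)) a 1# (polyLt-≤ (ℕ.m≤n⇒m≤1+n (ℕ.m≤n+m l j)) pg)
      (polyLt-var (j + l) (polyLt-* j l ph pg)))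

  -- The factor theorem in Horner form: if f = a + y h and h = h(r) + (y - r) g, then the quotient
  -- of f by y - r is h(r) + y g. Writing y as `r ⊕ d` avoids the subtraction.
  polyLt-factor : ∀ j {f} r → PolyLt (suc j) f →
    ∃ λ g → PolyLt j g × (∀ d → f (r ⊕ d) ≡ f r ⊕ d ⊗ g (r ⊕ d))
  polyLt-factor zero {f} r (a , h , h≗0 , eq) = h , h≗0 , λ d → begin
      f (r ⊕ d)                          ≡⟨ const (r ⊕ d) ⟩
      a                                  ≡⟨ const r ⟨
      f r                                ≡⟨ solve 2 (λ x d → x := x :+ d :* con 0) refl (f r) d ⟩
      f r ⊕ d ⊗ 0#                       ≡⟨ cong (λ x → f r ⊕ d ⊗ x) (h≗0 (r ⊕ d)) ⟨
      f r ⊕ d ⊗ h (r ⊕ d)                ∎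
    where
    open ≡-Reasoning
    const : ∀ y → f y ≡ a
    const y = trans (eq y) (trans (cong (λ x → a ⊕ y ⊗ x) (h≗0 y))
      (solve 2 (λ a y → a :+ y :* con 0 := a) refl a y))
  polyLt-factor (suc j) {f} r (a , h , ph , eq) with g , pg , eqg ← polyLt-factor j r ph =
    (λ y → h r ⊕ y ⊗ g y) , (h r , g , pg , λ _ → refl) , λ d → begin
      f (r ⊕ d)                                        ≡⟨ eq (r ⊕ d) ⟩
      a ⊕ (r ⊕ d) ⊗ h (r ⊕ d)                          ≡⟨ cong (λ x → a ⊕ (r ⊕ d) ⊗ x) (eqg d) ⟩
      a ⊕ (r ⊕ d) ⊗ (h r ⊕ d ⊗ g (r ⊕ d))              ≡⟨ solve 5 (λ a r d h g →
        a :+ (r :+ d) :* (h :+ d :* g) := (a :+ r :* h) :+ d :* (h :+ (r :+ d) :* g)) refl a r d (h r) (g (r ⊕ d)) ⟩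
      (a ⊕ r ⊗ h r) ⊕ d ⊗ (h r ⊕ (r ⊕ d) ⊗ g (r ⊕ d))  ≡⟨ cong (_⊕ d ⊗ (h r ⊕ (r ⊕ d) ⊗ g (r ⊕ d))) (eq r) ⟨
      f r ⊕ d ⊗ (h r ⊕ (r ⊕ d) ⊗ g (r ⊕ d))            ∎
    where open ≡-Reasoning

  polyLt-roots : ∀ j {f} (ys : List Carrier) → Unique ys → j ≤ length ys → PolyLt j f →
    (∀ {y} → y ∈ ys → f y ≡ 0#) → ∀ y → f y ≡ 0#
  polyLt-roots zero    _        _          _       p _     = p
  polyLt-roots (suc j) {f} (r ∷ ys) (r∉ys ∷ u) (s≤s j≤) p roots with g , pg , eq ← polyLt-factor j r p = vanish
    where
    f-near : ∀ d → f (r ⊕ d) ≡ d ⊗ g (r ⊕ d)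
    f-near d = trans (eq d) (trans (cong (_⊕ d ⊗ g (r ⊕ d)) (roots (here refl))) (+-identityˡ _))
    g-roots : ∀ {y} → y ∈ ys → g y ≡ 0#
    g-roots {y} y∈ with d , ι , refl , ι⊗d≡1 ← difference {y} {r} (λ y≡r → All.lookup r∉ys y∈ (sym y≡r)) =
      ⊗-cancelˡ-0 (λ d≡0 → 1≢0 (trans (sym ι⊗d≡1) (trans (cong (ι ⊗_) d≡0) (zeroʳ ι))))
        (trans (sym (f-near d)) (roots (there y∈)))
    vanish : ∀ y → f y ≡ 0#
    vanish y with y ≟ r
    ... | yes refl = roots (here refl)
    ... | no  y≢r with d , _ , refl , _ ← difference {y} {r} y≢r =
      trans (f-near d) (trans (cong (d ⊗_) (polyLt-roots j ys u j≤ pg g-roots (r ⊕ d))) (zeroʳ d))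

-- The Rédei polynomial and its multiples.

module Redei {c : Level} {q : ℕ} (F : FiniteField c q) where
  open Polynomials F
  open PolynomialFunctions F
  open Elements F
  open Directions F using (Point)
  open RingProperties ring using (-1*x≈-x; -‿involutive; +-cancelʳ)

  -- A polynomial in X over the ring of functions of the slope y.
  Family : Set c
  Family = Carrier → Poly

  -- The coefficient of X^i has degree at most k - i in y, written without subtraction. The case j =
  -- 0 says that coefficients beyond k vanish.
  TotalDegree≤ : ℕ → Family → Set c
  TotalDegree≤ k P = ∀ i j → k < i + j → PolyLt j (λ y → P y i)

  totalDegree⇒degLt : ∀ {k P} → TotalDegree≤ k P → ∀ y → DegLt (suc k) (P y)
  totalDegree⇒degLt {k} t y i k<i = t i 0 (subst (k <_) (sym (ℕ.+-identityʳ i)) k<i) y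

  -- Points have the same intercept at y when the line joining them has slope y.
  intercept : Carrier → Point → Carrier
  intercept y (a , b) = b ⊕ y ⊗ (⊖ a)

  redei : List Point → Family
  redei []      y = one
  redei (P ∷ U) y = lin (intercept y P) (redei U y)

  redei-degree : ∀ U → TotalDegree≤ (length U) (redei U)
  redei-degree [] zero    (suc j) _ = 1# , (λ _ → 0#) , polyLt-0 j (λ _ → refl) , λ y →
    solve 1 (λ y → con 1 := con 1 :+ y :* con 0) refl y
  redei-degree [] (suc i) j       _ = polyLt-0 j λ _ → refl
  redei-degree ((a , b) ∷ U) zero    (suc j) (s≤s U<j) = polyLt-linear (suc j) (⊖ a) b (redei-degree U 0 j U<j)
  redei-degree ((a , b) ∷ U) (suc i) j       (s≤s U<i+j) = polyLt-resp j
    (λ y → cong₂ _⊕_ (*-identityˡ _) (*-identityˡ _))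
    (polyLt-combine j 1# 1# (redei-degree U i j U<i+j)
      (polyLt-linear j (⊖ a) b (redei-degree U (suc i) (pred j) (bound j U<i+j))))
    where
    bound : ∀ j → length U < i + j → length U < suc i + pred j
    bound zero    U<i+0   = ℕ.m<n⇒m<1+n U<i+0
    bound (suc j) U<i+1+j = subst (length U <_) (ℕ.+-suc i j) U<i+1+j

  redei-monic : ∀ U y → redei U y (length U) ≡ 1#
  redei-monic []      y = refl
  redei-monic (P ∷ U) y = trans
    (cong₂ (λ s t → s ⊕ intercept y P ⊗ t) (redei-monic U y)
      (totalDegree⇒degLt (redei-degree U) y (suc (length U)) ℕ.≤-refl))
    (trans (cong (1# ⊕_) (zeroʳ _)) (+-identityʳ 1#))

  mult-redei-++ : ∀ {r k y V} U → Mult r k (redei V y) → Mult r k (redei (U ++ V) y)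
  mult-redei-++         []      m = m
  mult-redei-++ {k = k} (P ∷ U) m = mult-lin k _ (mult-redei-++ U m)

  mult-redei-∈ : ∀ {P U} k y V → P ∈ U → Mult (intercept y P) k (redei V y) →
    Mult (intercept y P) (suc k) (redei (U ++ V) y)
  mult-redei-∈ {U = _ ∷ U} k y V (here refl) m = _ , mult-redei-++ U m , λ _ → refl
  mult-redei-∈ {U = Q ∷ U} k y V (there P∈U) m = mult-lin (suc k) _ (mult-redei-∈ k y V P∈U m)

  mult-redei : ∀ {P U} y → P ∈ U → Mult (intercept y P) 1 (redei U y)
  mult-redei {P} {U} y P∈U = subst (λ V → Mult (intercept y P) 1 (redei V y)) (++-identityʳ U)
    (mult-redei-∈ 0 y [] P∈U (1 , one-degree))

  -- Each a in A contributes the point (a , b), whose intercept at slope 0 is b.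
  mult-redei-horizontal : ∀ {b B} A → b ∈ B → Mult b (length A) (redei (cartesianProduct A B) 0#)
  mult-redei-horizontal []      _ = 1 , one-degree
  mult-redei-horizontal {b} {B} (a ∷ A) b∈B =
    subst (λ r → Mult r (suc (length A)) (redei (cartesianProduct (a ∷ A) B) 0#)) height
      (mult-redei-∈ (length A) 0# (cartesianProduct A B) (∈-map⁺ (a ,_) b∈B)
        (subst (λ r → Mult r (length A) (redei (cartesianProduct A B) 0#)) (sym height) (mult-redei-horizontal A b∈B)))
    where
    height : intercept 0# (a , b) ≡ b
    height = trans (cong (b ⊕_) (zeroˡ (⊖ a))) (+-identityʳ b)

  fermat : Poly
  fermat = combine 1# (shiftN q one) -1# (shiftN 1 one)

  -- With s = -r and s^q = s, X^q - X = (X^q - s^q) - (X - s), and X - s divides every X^k - s^k.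
  mult-fermat : ∀ r → Mult r 1 fermat
  mult-fermat r = mult-resp 1 constants-cancel (mult-combine 1 {1#} {_} { -1# } (mult-power q) (mult-power 1))
    where
    s = ⊖ r
    power : ℕ → Poly
    power k = combine 1# (shiftN k one) (-1# ⊗ s ↑ k) one

    constants-cancel : combine 1# (power q) -1# (power 1) ≗ fermat
    constants-cancel i = begin
      1# ⊗ (1# ⊗ x ⊕ (-1# ⊗ s ↑ q) ⊗ e) ⊕ -1# ⊗ (1# ⊗ z ⊕ (-1# ⊗ (s ⊗ 1#)) ⊗ e)
        ≡⟨ cong (λ u → 1# ⊗ (1# ⊗ x ⊕ (-1# ⊗ u) ⊗ e) ⊕ -1# ⊗ (1# ⊗ z ⊕ (-1# ⊗ (s ⊗ 1#)) ⊗ e)) (x↑q≡x s) ⟩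
      1# ⊗ (1# ⊗ x ⊕ (-1# ⊗ s) ⊗ e) ⊕ -1# ⊗ (1# ⊗ z ⊕ (-1# ⊗ (s ⊗ 1#)) ⊗ e)
        ≡⟨ solve 5 (λ x n s e z → con 1 :* (con 1 :* x :+ (n :* s) :* e) :+ n :* (con 1 :* z :+ (n :* (s :* con 1)) :* e)
                     := (con 1 :* x :+ n :* z) :+ (n :* s :* e :+ n :* (n :* s :* e))) refl x -1# s e z ⟩
      (1# ⊗ x ⊕ -1# ⊗ z) ⊕ (-1# ⊗ s ⊗ e ⊕ -1# ⊗ (-1# ⊗ s ⊗ e))
        ≡⟨ cong ((1# ⊗ x ⊕ -1# ⊗ z) ⊕_) (x⊕[-1⊗x]≡0 _) ⟩
      (1# ⊗ x ⊕ -1# ⊗ z) ⊕ 0#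
        ≡⟨ +-identityʳ _ ⟩
      1# ⊗ x ⊕ -1# ⊗ z
        ∎
      where
      open ≡-Reasoning
      x = shiftN q one i
      e = one i
      z = shiftN 1 one i

    -1⊗s≡r : -1# ⊗ s ≡ r
    -1⊗s≡r = trans (-1*x≈-x s) (-‿involutive r)

    mult-power : ∀ k → Mult r 1 (power k)
    mult-power zero = (λ _ → 0#) , (0 , λ _ _ → refl) , λ
      { zero    → trans (1-1≡0 1#) (sym (zeroʳ r))
      ; (suc i) → trans (1-1≡0 0#) (sym (0⊕0 refl refl)) }
      where
      1-1≡0 : ∀ x → 1# ⊗ x ⊕ (-1# ⊗ 1#) ⊗ x ≡ 0#
      1-1≡0 x = trans (solve 2 (λ x n → con 1 :* x :+ (n :* con 1) :* x := x :+ n :* x) refl x -1#) (x⊕[-1⊗x]≡0 x)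
    -- X^(k + 1) - s^(k + 1) = X (X^k - s^k) + s^k (X - s), where X - s = X + r.
    mult-power (suc k) = mult-resp 1 step
      (mult-combine 1 {1#} {_} {s ↑ k} (mult-lin 1 0# (mult-power k)) (mult-linN 1 (1 , one-degree)))
      where
      open ≡-Reasoning
      step : combine 1# (lin 0# (power k)) (s ↑ k) (lin r one) ≗ power (suc k)
      step zero = begin
        1# ⊗ (0# ⊗ power k 0) ⊕ s ↑ k ⊗ (r ⊗ 1#)
          ≡⟨ cong (λ r → 1# ⊗ (0# ⊗ power k 0) ⊕ s ↑ k ⊗ (r ⊗ 1#)) -1⊗s≡r ⟨
        1# ⊗ (0# ⊗ power k 0) ⊕ s ↑ k ⊗ ((-1# ⊗ s) ⊗ 1#)
          ≡⟨ solve 4 (λ p u n s → con 1 :* (con 0 :* p) :+ u :* ((n :* s) :* con 1) :=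
               con 1 :* con 0 :+ (n :* (s :* u)) :* con 1) refl (power k 0) (s ↑ k) -1# s ⟩
        1# ⊗ 0# ⊕ (-1# ⊗ (s ⊗ s ↑ k)) ⊗ 1#
          ∎
      step (suc i) = begin
        1# ⊗ ((1# ⊗ x ⊕ (-1# ⊗ s ↑ k) ⊗ e) ⊕ 0# ⊗ power k (suc i)) ⊕ s ↑ k ⊗ (e ⊕ r ⊗ 0#)
          ≡⟨ solve 6 (λ x n u e p r →
               con 1 :* ((con 1 :* x :+ (n :* u) :* e) :+ con 0 :* p) :+ u :* (e :+ r :* con 0) :=
               x :+ (u :* e :+ n :* (u :* e))) refl x -1# (s ↑ k) e (power k (suc i)) r ⟩
        x ⊕ (s ↑ k ⊗ e ⊕ -1# ⊗ (s ↑ k ⊗ e))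
          ≡⟨ cong (x ⊕_) (x⊕[-1⊗x]≡0 (s ↑ k ⊗ e)) ⟩
        x ⊕ 0#
          ≡⟨ solve 2 (λ x v → x :+ con 0 := con 1 :* x :+ v :* con 0) refl x (-1# ⊗ (s ⊗ s ↑ k)) ⟩
        1# ⊗ x ⊕ (-1# ⊗ (s ⊗ s ↑ k)) ⊗ 0#
          ∎
        where
        x = shiftN k one i
        e = one i

  -- X ^ (d + n) + (terms of degree < n), as a multiple of the Rédei polynomial of U.
  -- Each step multiplies by X and cancels the coefficient of X ^ n, n = |U|.
  module _ (U : List Point) (n′ : ℕ) (|U|≡1+n′ : length U ≡ suc n′) where
    private
      n = suc n′

      redei-degree′ : TotalDegree≤ n (redei U)
      redei-degree′ = subst (λ k → TotalDegree≤ k (redei U)) |U|≡1+n′ (redei-degree U)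

      redei-monic′ : ∀ y → redei U y n ≡ 1#
      redei-monic′ y = subst (λ k → redei U y k ≡ 1#) |U|≡1+n′ (redei-monic U y)

    reduced : ℕ → Family
    reduced zero    y = redei U y
    reduced (suc d) y = combine 1# (shift (reduced d y)) (-1# ⊗ reduced d y n′) (redei U y)

    mult-reduced : ∀ d k y {r} → Mult r k (redei U y) → Mult r k (reduced d y)
    mult-reduced zero    k y m = m
    mult-reduced (suc d) k y m = mult-combine k
      (mult-resp k lin-0 (mult-lin k 0# (mult-reduced d k y m))) m
      where
      lin-0 : ∀ {P} → lin 0# P ≗ shift P
      lin-0     zero    = zeroˡ _
      lin-0 {P} (suc i) = trans (cong (P i ⊕_) (zeroˡ _)) (+-identityʳ _)

    -- The cancelled coefficient, at n - 1 before the shift, has degree at most d + 1 in y, and that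
    -- of X^i in the Rédei polynomial at most n - i. Their product fits the total degree d + 1 + n,
    -- which the shift by X also attains.
    reduced-degree : ∀ d → TotalDegree≤ (d + n) (reduced d)
    reduced-degree zero    = redei-degree′
    reduced-degree (suc d) i j 1+d+n<i+j = polyLt-resp j
      (λ y → solve 4 (λ a b c m → con 1 :* a :+ m :* (b :* c) := con 1 :* a :+ (m :* b) :* c)
        refl (shift (reduced d y) i) (reduced d y n′) (redei U y i) -1#)
      (polyLt-combine j 1# -1# (shifted i 1+d+n<i+j) correction)
      where
      shifted : ∀ i → suc d + n < i + j → PolyLt j (λ y → shift (reduced d y) i)
      shifted zero    _               = polyLt-0 j λ _ → refl
      shifted (suc i) (s≤s d+n<i+j) = reduced-degree d i j d+n<i+j

      correction : PolyLt j (λ y → reduced d y n′ ⊗ redei U y i)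
      correction with suc d ℕ.≤? j
      -- Here i exceeds n, the degree of the Rédei polynomial.
      ... | no  1+d≰j = polyLt-0 j λ y → trans
        (cong (reduced d y n′ ⊗_) (totalDegree⇒degLt redei-degree′ y i n<i)) (zeroʳ _)
        where
        n<i : n < i
        n<i = ℕ.+-cancelˡ-< (suc d) n i (ℕ.<-≤-trans 1+d+n<i+j
          (ℕ.≤-trans (ℕ.+-monoʳ-≤ i (ℕ.<⇒≤ (ℕ.≰⇒> 1+d≰j))) (ℕ.≤-reflexive (ℕ.+-comm i (suc d)))))
      ... | yes 1+d≤j with l , refl ← ℕ.m≤n⇒∃[o]m+o≡n 1+d≤j =
        polyLt-* (suc d) l (reduced-degree d n′ (suc (suc d)) d+n<) (redei-degree′ i l n<i+l)
        where
        d+n< : d + n < n′ + suc (suc d)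
        d+n< = ℕ.≤-reflexive (begin
          suc d + n           ≡⟨ ℕ.+-suc (suc d) n′ ⟩
          suc (suc d) + n′    ≡⟨ ℕ.+-comm (suc (suc d)) n′ ⟩
          n′ + suc (suc d)    ∎)
          where open ≡-Reasoning
        n<i+l : n < i + l
        n<i+l = ℕ.+-cancelˡ-< (suc d) n (i + l) (subst (suc d + n <_) (begin
          i + (suc d + l)     ≡⟨ ℕ.+-assoc i (suc d) l ⟨
          i + suc d + l       ≡⟨ cong (_+ l) (ℕ.+-comm i (suc d)) ⟩
          suc d + i + l       ≡⟨ ℕ.+-assoc (suc d) i l ⟩
          suc d + (i + l)     ∎) 1+d+n<i+j)
          where open ≡-Reasoning

    private
      -1⊗x⊗0 : ∀ {a x b} → b ≡ 0# → 1# ⊗ a ⊕ x ⊗ b ≡ a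
      -1⊗x⊗0 {a} {x} refl = solve 2 (λ a x → con 1 :* a :+ x :* con 0 := a) refl a x

      redei-high : ∀ y i → n < i → redei U y i ≡ 0#
      redei-high y = totalDegree⇒degLt redei-degree′ y

    reduced-monic : ∀ d y → reduced d y (d + n) ≡ 1#
    reduced-monic zero    y = redei-monic′ y
    reduced-monic (suc d) y = trans (-1⊗x⊗0 (redei-high y _ (s≤s (ℕ.m≤n+m n d)))) (reduced-monic d y)

    reduced-gap : ∀ d y i → n ≤ i → i < d + n → reduced d y i ≡ 0#
    reduced-gap zero    y i       n≤i i<n = ⊥-elim (ℕ.<⇒≱ i<n n≤i)
    reduced-gap (suc d) y (suc i) n≤1+i (s≤s i<d+n) with n ℕ.≤? i
    ... | yes n≤i = trans (-1⊗x⊗0 (redei-high y _ (s≤s n≤i))) (reduced-gap d y i n≤i i<d+n)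
    ... | no  n≰i with refl ← ℕ.≤-antisym (ℕ.≤-pred n≤1+i) (ℕ.≤-pred (ℕ.≰⇒> n≰i)) = begin
      1# ⊗ w ⊕ (-1# ⊗ w) ⊗ redei U y n  ≡⟨ cong (λ x → 1# ⊗ w ⊕ (-1# ⊗ w) ⊗ x) (redei-monic′ y) ⟩
      1# ⊗ w ⊕ (-1# ⊗ w) ⊗ 1#           ≡⟨ solve 2 (λ w m → con 1 :* w :+ (m :* w) :* con 1 := w :+ m :* w) refl w -1# ⟩
      w ⊕ -1# ⊗ w                       ≡⟨ x⊕[-1⊗x]≡0 w ⟩
      0#                                ∎
      where
      open ≡-Reasoning
      w = reduced d y n′

    private
      fermat-middle : ∀ i → 2 ≤ i → i < q → fermat i ≡ 0#
      fermat-middle (suc zero)    (s≤s ()) _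
      fermat-middle (suc (suc i)) _ i<q = 0⊗0 (shiftN-< one i<q) refl

      fermat-lead : 2 ≤ q → fermat q ≡ 1#
      fermat-lead 2≤q = trans (cong₂ (λ x z → 1# ⊗ x ⊕ -1# ⊗ z) lead (tail q 2≤q))
        (-1⊗x⊗0 {1#} { -1# } refl)
        where
        lead : shiftN q one q ≡ 1#
        lead = trans (cong (shiftN q one) (sym (ℕ.+-identityʳ q))) (shiftN-+ q one 0)
        tail : ∀ i → 2 ≤ i → shiftN 1 one i ≡ 0#
        tail (suc zero)    (s≤s ())
        tail (suc (suc i)) _ = refl

      fermat-high : 2 ≤ q → ∀ i → q < i → fermat i ≡ 0#
      fermat-high 2≤q i q<i with j , refl ← ℕ.m≤n⇒∃[o]m+o≡n q<i = 0⊗0 high (tail (ℕ.≤-trans 2≤q (ℕ.m≤m+n q j)))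
        where
        high : shiftN q one (suc q + j) ≡ 0#
        high = trans (cong (shiftN q one) (sym (ℕ.+-suc q j))) (shiftN-+ q one (suc j))
        tail : ∀ {i} → 2 ≤ i → one i ≡ 0#
        tail {suc _} _ = refl

    -- `reduced d y` and X^q - X agree in all coefficients from n on; 2 ≤ n keeps the term -X out of
    -- that range. Their difference has degree below n and n distinct roots, so they coincide.
    reduced-vanishes : ∀ d y → 2 ≤ n → d + n ≡ q → Unique (map (intercept y) U) →
      ∀ i → 2 ≤ i → i < q → reduced d y i ≡ 0#
    reduced-vanishes d y 2≤n d+n≡q distinct i 2≤i i<q =
      trans (1⊗x⊕[-1⊗y]≡0⇒x≡y (mult-degree roots distinct 1 low mult i z≤n)) (fermat-middle i 2≤i i<q)
      where
      roots = map (intercept y) U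

      n≤q : n ≤ q
      n≤q = subst (n ≤_) d+n≡q (ℕ.m≤n+m n d)

      low : DegLt (length roots * 1) (combine 1# (reduced d y) -1# fermat)
      low i n≤i′ = 1⊗x⊕[-1⊗x]≡0 agree
        where
        n≤i : n ≤ i
        n≤i = subst (_≤ i) (trans (ℕ.*-identityʳ _) (trans (length-map (intercept y) U) |U|≡1+n′)) n≤i′
        agree : reduced d y i ≡ fermat i
        agree with ℕ.<-cmp i q
        ... | tri< i<q _ _  = trans (reduced-gap d y i n≤i (subst (i <_) (sym d+n≡q) i<q))
                                    (sym (fermat-middle i (ℕ.≤-trans 2≤n n≤i) i<q))
        ... | tri≈ _ i≡q _  = trans (subst (λ j → reduced d y j ≡ 1#) (trans d+n≡q (sym i≡q)) (reduced-monic d y))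
                                    (sym (trans (cong fermat i≡q) (fermat-lead (ℕ.≤-trans 2≤n n≤q))))
        ... | tri> _ _ q<i  = trans (totalDegree⇒degLt (reduced-degree d) y i (subst (_< i) (sym d+n≡q) q<i))
                                    (sym (fermat-high (ℕ.≤-trans 2≤n n≤q) i q<i))

      mult : ∀ {r} → r ∈ roots → Mult r 1 (combine 1# (reduced d y) -1# fermat)
      mult r∈ with P , P∈U , refl ← ∈-map⁻ (intercept y) r∈ =
        mult-combine 1 (mult-reduced d 1 y (mult-redei y P∈U)) (mult-fermat (intercept y P))

  -- From a list covering the directions to the bound.

  -- Intercepts replace the quotients defining slopes. Only containment is asked of L, so any list
  -- of the right length that covers the non-vertical directions serves.
  Covers : List Carrier → List Carrier → List (Maybe Carrier) → Set c
  Covers A B L = ∀ {a a′ b b′} → a ∈ A → a′ ∈ A → b ∈ B → b′ ∈ B → a ≢ a′ →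
    ∀ y → intercept y (a , b) ≡ intercept y (a′ , b′) → just y ∈ L

  module _ (L : List (Maybe Carrier)) where
    open DecMembership (Maybe.≡-dec _≟_) using (_∈?_)

    uncovered : List Carrier
    uncovered = filter (λ y → ¬? (just y ∈? L)) elements

    uncovered-unique : Unique uncovered
    uncovered-unique = filter⁺ _ elements-unique

    ∈-uncovered⁻ : ∀ {y} → y ∈ uncovered → just y ∉ L
    ∈-uncovered⁻ y∈ = proj₂ (∈-filter⁻ _ {xs = elements} y∈)

    -- All q + 1 directions are counted; ∞ lies in L, and this extra direction makes the inequality
    -- strict.
    length-uncovered : nothing ∈ L → q < length uncovered + length L
    length-uncovered ∞∈L = subst₂ _≤_ (cong suc (trans (length-map just elements) length-elements))
      (trans (length-++ (map just uncovered)) (cong (_+ length L) (length-map just uncovered)))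
      (length-⊆ (All.tabulate nothing∉ ∷ map⁺ Maybe.just-injective elements-unique) each)
      where
      nothing∉ : ∀ {δ} → δ ∈ map just elements → nothing ≢ δ
      nothing∉ δ∈ refl with _ , _ , () ← ∈-map⁻ just δ∈
      each : ∀ {δ} → δ ∈ nothing ∷ map just elements → δ ∈ map just uncovered ++ L
      each (here refl) = ∈-++⁺ʳ _ ∞∈L
      each (there δ∈) with y , _ , refl ← ∈-map⁻ just δ∈ with just y ∈? L
      ... | yes y∈L = ∈-++⁺ʳ _ y∈L
      ... | no  y∉L = ∈-++⁺ˡ (∈-map⁺ just (∈-filter⁺ _ (∈-elements y) y∉L))

  distinct-intercepts : ∀ {A B L y} → Unique A → Unique B → Covers A B L → just y ∉ L →
    Unique (map (intercept y) (cartesianProduct A B))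
  distinct-intercepts {A} {B} {L} {y} uA uB covers y∉L = unique-map-on (cartesianProduct⁺ uA uB) injective
    where
    injective : ∀ {P Q} → P ∈ cartesianProduct A B → Q ∈ cartesianProduct A B →
      intercept y P ≡ intercept y Q → P ≡ Q
    injective {a , b} {a′ , b′} P∈ Q∈ eq with a ≟ a′
    ... | yes refl = cong (a ,_) (+-cancelʳ _ b b′ eq)
    ... | no  a≢a′ with a∈ , b∈ ← ∈-cartesianProduct⁻ A B P∈ | a′∈ , b′∈ ← ∈-cartesianProduct⁻ A B Q∈ =
      ⊥-elim (y∉L (covers a∈ a′∈ b∈ b′∈ a≢a′ y eq))

  directions-bound : ∀ p h → Prime p → q ≡ p ^ h → ∀ A B → Unique A → Unique B →
    2 ≤ length A → 2 ≤ length B → length A * length B ≤ q →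
    ∀ L → nothing ∈ L → just 0# ∈ L → Covers A B L →
    ∃ λ s → p ^ s * length B ≤ q × length A * length B < length L + p ^ s * (length B ∸ 1)
  directions-bound zero    h p-prime = ⊥-elim (¬prime[0] p-prime)
  directions-bound (suc p′) h p-prime q≡p^h A@(a ∷ A′) B@(b ∷ B′) uA uB 2≤m 2≤n mn≤q L ∞∈L 0∈L covers =
    s , subst (suc p′ ^ s * length B ≤_) (sym q≡p^h) (proj₁ (proj₂ result)) ,
      subst (λ l → length A * length B < l + suc p′ ^ s * (length B ∸ 1)) |L|≡1+e (s≤s (proj₂ (proj₂ result)))
    where
    U = cartesianProduct A B
    |U|≡mn : length U ≡ length A * length B
    |U|≡mn = length-cartesianProduct A B
    n′ = pred (length A * length B)
    -- Coefficients vanish from |L| on, while `lacunary` wants them zero strictly above e. The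
    -- difference becomes the + 1 of the theorem.
    e = pred (length L)
    d = q ∸ length A * length B

    d+n≡q : d + suc n′ ≡ q
    d+n≡q = ℕ.m∸n+n≡m mn≤q

    -- Every index in the gap must exceed 1, the exponent of the term -X in X^q - X.
    2≤|L| : 2 ≤ length L
    2≤|L| = length-⊆ {xs = nothing ∷ just 0# ∷ []} (((λ ()) ∷ []) ∷ [] ∷ [])
      λ { (here refl) → ∞∈L ; (there (here refl)) → 0∈L }

    |L|≡1+e : suc e ≡ length L
    |L|≡1+e = ℕ.suc-pred (length L) {{>-nonZero (ℕ.<-≤-trans (s≤s z≤n) 2≤|L|)}}

    2≤mn : 2 ≤ suc n′
    2≤mn = ℕ.≤-trans 2≤n (ℕ.m≤m+n (length B) _)

    W : Poly
    W = reduced U n′ |U|≡mn d 0#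

    -- The degree in y is at most q - i, below the number of uncovered slopes, so the vanishing
    -- extends to the covered slope 0.
    gap : ∀ i → e < i → i < q → W i ≡ 0#
    gap i e<i i<q = polyLt-roots (length (uncovered L)) (uncovered L) (uncovered-unique L) ℕ.≤-refl
      (reduced-degree U n′ |U|≡mn d i (length (uncovered L)) degree)
      (λ {y} y∈ → reduced-vanishes U n′ |U|≡mn d y 2≤mn d+n≡q
        (distinct-intercepts uA uB covers (∈-uncovered⁻ L y∈)) i (ℕ.≤-trans 2≤|L| |L|≤i) i<q) 0#
      where
      |L|≤i : length L ≤ i
      |L|≤i = subst (_≤ i) |L|≡1+e e<i
      degree : d + suc n′ < i + length (uncovered L)
      degree = subst (_< i + length (uncovered L)) (sym d+n≡q) (ℕ.<-≤-trans (length-uncovered L ∞∈L)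
        (ℕ.≤-trans (ℕ.+-monoʳ-≤ (length (uncovered L)) |L|≤i) (ℕ.≤-reflexive (ℕ.+-comm _ i))))

    Q≡ : d + suc n′ ≡ suc p′ ^ h
    Q≡ = trans d+n≡q q≡p^h

    open Lacunary F p′ p-prime (prime-char (suc p′) h q≡p^h) using (lacunary)
    result = lacunary h {W} e B uB 2≤n (length A′)
      (subst (λ k → W k ≡ 1#) Q≡ (reduced-monic U n′ |U|≡mn d 0#))
      (subst (λ k → DegLt (suc k) W) Q≡ (totalDegree⇒degLt (reduced-degree U n′ |U|≡mn d) 0#))
      (λ i e<i i<Q → gap i e<i (subst (i <_) (sym q≡p^h) i<Q))
      (λ b∈B → mult-reduced U n′ |U|≡mn d (length A) 0# (mult-redei-horizontal A b∈B))
    s = proj₁ result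

  -- Exchange of the two coordinates.

  swap-slope : Maybe Carrier → Maybe Carrier
  swap-slope nothing = just 0#
  swap-slope (just y) with y ≟ 0#
  ... | yes _   = nothing
  ... | no  y≢0 = just (proj₁ (inverse y≢0))

  swap-0 : swap-slope (just 0#) ≡ nothing
  swap-0 with 0# ≟ 0#
  ... | yes _   = refl
  ... | no  0≢0 = ⊥-elim (0≢0 refl)

  -- Slope 0 is the image of ∞. For y ≢ 0, the intercept of (b , a) at y, divided by y, is minus the
  -- intercept of (a , b) at 1 / y, so equal intercepts stay equal.
  covers-swap : ∀ {A B L} → nothing ∈ L → Covers A B L → Covers B A (map swap-slope L)
  covers-swap {A} {B} {L} ∞∈L covers {b} {b′} {a} {a′} b∈ b′∈ a∈ a′∈ b≢b′ y eq with y ≟ 0#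
  ... | yes refl = ∈-map⁺ swap-slope ∞∈L
  ... | no  y≢0 with ι , ι⊗y≡1 ← inverse y≢0 =
    subst (_∈ map swap-slope L) (swap-slope-inverse ι⊗y≡1)
      (∈-map⁺ swap-slope (covers a∈ a′∈ b∈ b′∈ a≢a′ ι same-intercept))
    where
    open ≡-Reasoning
    swap-slope-inverse : ∀ {ι} → ι ⊗ y ≡ 1# → swap-slope (just ι) ≡ just y
    swap-slope-inverse {ι} ι⊗y≡1 with ι ≟ 0#
    ... | yes refl = ⊥-elim (1≢0 (trans (sym ι⊗y≡1) (zeroˡ y)))
    ... | no  ι≢0 = cong just (begin
      κ               ≡⟨ *-identityʳ κ ⟨
      κ ⊗ 1#          ≡⟨ cong (κ ⊗_) ι⊗y≡1 ⟨
      κ ⊗ (ι ⊗ y)     ≡⟨ solve 3 (λ κ ι y → κ :* (ι :* y) := (κ :* ι) :* y) refl κ ι y ⟩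
      (κ ⊗ ι) ⊗ y     ≡⟨ cong (_⊗ y) κ⊗ι≡1 ⟩
      1# ⊗ y          ≡⟨ *-identityˡ y ⟩
      y               ∎)
      where
      κ = proj₁ (inverse ι≢0)
      κ⊗ι≡1 = proj₂ (inverse ι≢0)

    scaled : ∀ a b → ι ⊗ intercept y (b , a) ≡ ι ⊗ a ⊕ ⊖ b
    scaled a b = begin
      ι ⊗ (a ⊕ y ⊗ (⊖ b))       ≡⟨ solve 4 (λ ι a y b → ι :* (a :+ y :* b) := ι :* a :+ (ι :* y) :* b) refl ι a y (⊖ b) ⟩
      ι ⊗ a ⊕ (ι ⊗ y) ⊗ (⊖ b)   ≡⟨ cong (λ x → ι ⊗ a ⊕ x ⊗ (⊖ b)) ι⊗y≡1 ⟩
      ι ⊗ a ⊕ 1# ⊗ (⊖ b)        ≡⟨ cong (ι ⊗ a ⊕_) (*-identityˡ (⊖ b)) ⟩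
      ι ⊗ a ⊕ ⊖ b               ∎

    cancel : ∀ a b → intercept ι (a , b) ⊕ (ι ⊗ a ⊕ ⊖ b) ≡ 0#
    cancel a b = begin
      (b ⊕ ι ⊗ (⊖ a)) ⊕ (ι ⊗ a ⊕ ⊖ b)   ≡⟨ solve 5 (λ a b ι a⁻ b⁻ →
        (b :+ ι :* a⁻) :+ (ι :* a :+ b⁻) := (b :+ b⁻) :+ ι :* (a :+ a⁻)) refl a b ι (⊖ a) (⊖ b) ⟩
      (b ⊕ ⊖ b) ⊕ ι ⊗ (a ⊕ ⊖ a)         ≡⟨ 0⊕0 (-‿inverseʳ b) (-‿inverseʳ a) ⟩
      0#                                ∎

    same-intercept : intercept ι (a , b) ≡ intercept ι (a′ , b′)
    same-intercept = +-cancelʳ (ι ⊗ a ⊕ ⊖ b) _ _ (begin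
      intercept ι (a , b) ⊕ (ι ⊗ a ⊕ ⊖ b)         ≡⟨ trans (cancel a b) (sym (cancel a′ b′)) ⟩
      intercept ι (a′ , b′) ⊕ (ι ⊗ a′ ⊕ ⊖ b′)     ≡⟨ cong (intercept ι (a′ , b′) ⊕_)
        (trans (sym (scaled a′ b′)) (trans (cong (ι ⊗_) (sym eq)) (scaled a b))) ⟩
      intercept ι (a′ , b′) ⊕ (ι ⊗ a ⊕ ⊖ b)       ∎)

    a≢a′ : a ≢ a′
    a≢a′ refl = b≢b′ (+-cancelʳ _ b b′ same-intercept)

-- The directions determined by a Cartesian product.

module DirectionList {c : Level} {q : ℕ} (F : FiniteField c q) where
  open Polynomials F
  open Redei F
  open Directions F
  open RingProperties ring using (+-cancelʳ)

  -- Each pair is oriented by position in the list, so only one of the two orientations is certain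
  -- to occur.
  ∈-directions : ∀ {P Q} U → P ∈ U → Q ∈ U → P ≢ Q →
    direction P Q ∈ directions U ⊎ direction Q P ∈ directions U
  ∈-directions (_ ∷ U) (here refl) (here refl) P≢P = ⊥-elim (P≢P refl)
  ∈-directions (R ∷ U) (here refl) (there Q∈)  _   = inj₁ (∈-++⁺ˡ (∈-map⁺ (direction R) Q∈))
  ∈-directions (R ∷ U) (there P∈)  (here refl) _   = inj₂ (∈-++⁺ˡ (∈-map⁺ (direction R) P∈))
  ∈-directions (R ∷ U) (there P∈)  (there Q∈)  P≢Q = Sum.map (∈-++⁺ʳ _) (∈-++⁺ʳ _) (∈-directions U P∈ Q∈ P≢Q)

  direction-vertical : ∀ a b b′ → direction (a , b) (a , b′) ≡ ∞
  direction-vertical a b b′ with a ≟ a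
  ... | yes _   = refl
  ... | no  a≢a = ⊥-elim (a≢a refl)

  direction-slope : ∀ {a a′ b b′ y} → a ≢ a′ → intercept y (a , b) ≡ intercept y (a′ , b′) →
    direction (a , b) (a′ , b′) ≡ just y
  direction-slope {a} {a′} {b} {b′} {y} a≢a′ eq with a′ ≟ a
  ... | yes a′≡a = ⊥-elim (a≢a′ (sym a′≡a))
  ... | no  a′≢a = cong just (begin
      (b′ ⊕ ⊖ b) ⊗ κ            ≡⟨ cong (_⊗ κ) rise ⟩
      (y ⊗ (a′ ⊕ ⊖ a)) ⊗ κ      ≡⟨ solve 3 (λ y r κ → (y :* r) :* κ := y :* (r :* κ)) refl y (a′ ⊕ ⊖ a) κ ⟩
      y ⊗ ((a′ ⊕ ⊖ a) ⊗ κ)      ≡⟨ cong (y ⊗_) (proj₂ (proj₂ (FiniteField.#⇒invertible F a′≢a))) ⟩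
      y ⊗ 1#                    ≡⟨ *-identityʳ y ⟩
      y                         ∎)
    where
    open ≡-Reasoning
    κ = proj₁ (FiniteField.#⇒invertible F a′≢a)
    rise : b′ ⊕ ⊖ b ≡ y ⊗ (a′ ⊕ ⊖ a)
    rise = +-cancelʳ (intercept y (a , b)) _ _ (begin
      (b′ ⊕ ⊖ b) ⊕ (b ⊕ y ⊗ (⊖ a))                   ≡⟨ solve 5 (λ b b′ b⁻ y a⁻ →
        (b′ :+ b⁻) :+ (b :+ y :* a⁻) := (b′ :+ y :* a⁻) :+ (b :+ b⁻)) refl b b′ (⊖ b) y (⊖ a) ⟩
      (b′ ⊕ y ⊗ (⊖ a)) ⊕ (b ⊕ ⊖ b)                   ≡⟨ cong ((b′ ⊕ y ⊗ (⊖ a)) ⊕_) (trans (-‿inverseʳ b) (sym (zeroʳ y))) ⟩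
      (b′ ⊕ y ⊗ (⊖ a)) ⊕ y ⊗ 0#                      ≡⟨ cong (λ x → (b′ ⊕ y ⊗ (⊖ a)) ⊕ y ⊗ x) (-‿inverseʳ a′) ⟨
      (b′ ⊕ y ⊗ (⊖ a)) ⊕ y ⊗ (a′ ⊕ ⊖ a′)             ≡⟨ solve 5 (λ b′ y a⁻ a′ a′⁻ →
        (b′ :+ y :* a⁻) :+ y :* (a′ :+ a′⁻) := y :* (a′ :+ a⁻) :+ (b′ :+ y :* a′⁻)) refl b′ y (⊖ a) a′ (⊖ a′) ⟩
      y ⊗ (a′ ⊕ ⊖ a) ⊕ (b′ ⊕ y ⊗ (⊖ a′))             ≡⟨ cong (y ⊗ (a′ ⊕ ⊖ a) ⊕_) eq ⟨
      y ⊗ (a′ ⊕ ⊖ a) ⊕ (b ⊕ y ⊗ (⊖ a))               ∎)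

  module _ (A B : List Carrier) where
    distinctDirections : List Direction
    distinctDirections = deduplicate (Maybe.≡-dec _≟_) (directions (cartesianProduct A B))

    joining∈ : ∀ {P Q δ} → P ∈ cartesianProduct A B → Q ∈ cartesianProduct A B → P ≢ Q →
      direction P Q ≡ δ → direction Q P ≡ δ → δ ∈ distinctDirections
    joining∈ P∈ Q∈ P≢Q PQ≡δ QP≡δ with ∈-directions (cartesianProduct A B) P∈ Q∈ P≢Q
    ... | inj₁ PQ∈ = subst (_∈ distinctDirections) PQ≡δ (∈-deduplicate⁺ _ PQ∈)
    ... | inj₂ QP∈ = subst (_∈ distinctDirections) QP≡δ (∈-deduplicate⁺ _ QP∈)

    covers-directions : Covers A B distinctDirections
    covers-directions a∈ a′∈ b∈ b′∈ a≢a′ y eq =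
      joining∈ (∈-cartesianProduct⁺ a∈ b∈) (∈-cartesianProduct⁺ a′∈ b′∈) (λ eq → a≢a′ (cong proj₁ eq))
        (direction-slope a≢a′ eq) (direction-slope (λ a′≡a → a≢a′ (sym a′≡a)) (sym eq))

    horizontal∈ : Unique A → 2 ≤ length A → 2 ≤ length B → just 0# ∈ distinctDirections
    horizontal∈ uA 2≤m 2≤n with _ , _ , a∈ , a′∈ , a≢a′ ← distinct-pair uA 2≤m | b , b∈ ← member {xs = B} 2≤n =
      covers-directions a∈ a′∈ b∈ b∈ a≢a′ 0# (cong (b ⊕_) (trans (zeroˡ _) (sym (zeroˡ _))))

    vertical∈ : Unique B → 2 ≤ length A → 2 ≤ length B → ∞ ∈ distinctDirections
    vertical∈ uB 2≤m 2≤n with b , b′ , b∈ , b′∈ , b≢b′ ← distinct-pair uB 2≤n | a , a∈ ← member {xs = A} 2≤m =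
      joining∈ (∈-cartesianProduct⁺ a∈ b∈) (∈-cartesianProduct⁺ a∈ b′∈) (λ eq → b≢b′ (cong proj₂ eq))
        (direction-vertical a b b′) (direction-vertical a b′ b)

  -- The second bound does not enumerate the directions of B × A: `map swap-slope L` covers them and
  -- has the length of L.
  numDirections-bounds : ∀ p h → Prime p → q ≡ p ^ h → ∀ A B → Unique A → Unique B →
    2 ≤ length A → 2 ≤ length B → length A * length B ≤ q →
    (∃ λ s → p ^ s * length B ≤ q ×
      length A * length B < numDirections (cartesianProduct A B) + p ^ s * (length B ∸ 1)) ×
    (∃ λ s → p ^ s * length A ≤ q ×
      length A * length B < numDirections (cartesianProduct A B) + p ^ s * (length A ∸ 1))
  numDirections-bounds p h p-prime q≡p^h A B uA uB 2≤m 2≤n mn≤q =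
    directions-bound p h p-prime q≡p^h A B uA uB 2≤m 2≤n mn≤q L ∞∈L 0∈L (covers-directions A B) ,
    swapped
    where
    L = distinctDirections A B
    ∞∈L = vertical∈ A B uB 2≤m 2≤n
    0∈L = horizontal∈ A B uA 2≤m 2≤n
    nm≡mn = ℕ.*-comm (length B) (length A)
    swapped : ∃ λ s → p ^ s * length A ≤ q × length A * length B < length L + p ^ s * (length A ∸ 1)
    swapped with s , p^s*m≤q , bound ← directions-bound p h p-prime q≡p^h B A uB uA 2≤n 2≤m
        (subst (_≤ q) (sym nm≡mn) mn≤q) (map swap-slope L)
        (subst (_∈ map swap-slope L) swap-0 (∈-map⁺ swap-slope 0∈L)) (∈-map⁺ swap-slope ∞∈L)
        (covers-swap ∞∈L (covers-directions A B)) =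
      s , p^s*m≤q , subst₂ (λ x l → x < l + p ^ s * (length A ∸ 1)) nm≡mn (length-map swap-slope L) bound

theorem1p7 : ∀ {c : Level} (p h q : ℕ) → Prime p → 1 ≤ h → q ≡ p ^ h →
    (F : FiniteField c q) →
    (A B : List (FiniteField.Carrier F)) → Unique A → Unique B →
    (m n : ℕ) → length A ≡ m → length B ≡ n →
    2 ≤ m → 2 ≤ n → m * n ≤ q →
    (s₁ s₂ : ℕ) →
    IsLargest (λ s → p ^ s * n ≤ q) s₁ →
    IsLargest (λ s → p ^ s * m ≤ q) s₂ →
    (+ (m * n) -ℤ + ((p ^ s₁ * (n ∸ 1)) ⊓ (p ^ s₂ * (m ∸ 1)))) +ℤ 1ℤ
    ≤ℤ + Directions.numDirections F (cartesianProduct A B)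
theorem1p7 p h q p-prime 1≤h q≡p^h F A B uA uB m n refl refl 2≤m 2≤n mn≤q s₁ s₂ (_ , s₁-max) (_ , s₂-max)
  with DirectionList.numDirections-bounds F p h p-prime q≡p^h A B uA uB 2≤m 2≤n mn≤q
... | (s , p^s*n≤q , bound₁) , (t , p^t*m≤q , bound₂) = begin
  (+ (m * n) -ℤ + k) +ℤ 1ℤ      ≡⟨ ℤ.+-comm (+ (m * n) -ℤ + k) 1ℤ ⟩
  1ℤ +ℤ (+ (m * n) -ℤ + k)      ≡⟨ ℤ.+-assoc 1ℤ (+ (m * n)) (- + k) ⟨
  + suc (m * n) -ℤ + k          ≤⟨ ℤ.+-monoˡ-≤ (- + k) (+≤+ mn<N+k) ⟩
  + N +ℤ + k -ℤ + k             ≡⟨ ℤ.+-assoc (+ N) (+ k) (- + k) ⟩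
  + N +ℤ (+ k -ℤ + k)           ≡⟨ cong (+ N +ℤ_) (ℤ.+-inverseʳ (+ k)) ⟩
  + N +ℤ + 0                    ≡⟨ ℤ.+-identityʳ (+ N) ⟩
  + N                           ∎
  where
  open ℤ.≤-Reasoning
  N k₁ k₂ k : ℕ
  N = Directions.numDirections F (cartesianProduct A B)
  k₁ = p ^ s₁ * (n ∸ 1)
  k₂ = p ^ s₂ * (m ∸ 1)
  k = k₁ ⊓ k₂

  power-mono : ∀ {s t} l → s ≤ t → p ^ s * l ≤ p ^ t * l
  power-mono l s≤t = ℕ.*-monoˡ-≤ l (ℕ.^-monoʳ-≤ p {{prime⇒nonZero p-prime}} s≤t)

  -- The exponents s and t merely satisfy the size conditions; by maximality they are at most `s₁`
  -- and `s₂`, and enlarging them weakens the bounds. As both bounds hold, the smaller of the two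
  -- terms may be taken.
  mn<N+k : m * n < N + k
  mn<N+k = subst (m * n <_) (sym (ℕ.+-distribˡ-⊓ N k₁ k₂)) (ℕ.⊓-glb
    (ℕ.<-≤-trans bound₁ (ℕ.+-monoʳ-≤ N (power-mono (n ∸ 1) (s₁-max s p^s*n≤q))))
    (ℕ.<-≤-trans bound₂ (ℕ.+-monoʳ-≤ N (power-mono (m ∸ 1) (s₂-max t p^t*m≤q)))))
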